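{- Let $p>3$ be a prime and $r$ a positive integer. Then $$\sum_{k=0}^{\frac{p^r-1}{2}} (4k+1) \left(\frac{(\frac12)_k}{k!}\right)^4\equiv p^r \pmod{p^{3+r}}.$$
   Context: For $a\in\mathbb{C}$ and $k\in\mathbb{N}$, $(a)_k=a(a+1)\cdots(a+k-1)$ denotes the rising factorial, with $(a)_0=1$. A congruence $A\equiv B \pmod{p^m}$ between rational numbers means that $A-B\in p^m\mathbb{Z}_{(p)}$ (i.e. $A-B$ is $p^m$ times a rational number whose denominator is prime to $p$). -}

module Defs where

open import Data.Nat as ℕ using (ℕ; zero; suc)
open import Data.Nat.Divisibility using (_∣_)
open import Data.Integer as ℤ using (ℤ)
open import Data.Rational using (ℚ; _+_; _*_; _-_; _/_; 1ℚ; 0ℚ)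
open import Data.Product using (∃; ∃-syntax; _×_)
open import Relation.Nullary using (¬_)
open import Relation.Binary.PropositionalEquality using (_≡_)

ℕ→ℚ : ℕ → ℚ
ℕ→ℚ n = ℤ.+ n / 1

rising : ℚ → ℕ → ℚ
rising a zero    = 1ℚ
rising a (suc k) = rising a k * (a + ℕ→ℚ k)

invFact : ℕ → ℚ
invFact zero    = 1ℚ
invFact (suc k) = invFact k * (ℤ.+ 1 / suc k)

pow : ℚ → ℕ → ℚ
pow x zero    = 1ℚ
pow x (suc n) = pow x n * x

half : ℚ
half = ℤ.+ 1 / 2

sumTo : ℕ → (ℕ → ℚ) → ℚ
sumTo zero    f = f 0
sumTo (suc n) f = sumTo n f + f (suc n)

-- A ≡ B (mod p^m) in ℤ_(p): A - B = p^m * (a / b) with p ∤ b, i.e.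
-- (A - B) * b = p^m * a for some integer a and natural b not divisible by p
CongMod : ℚ → ℚ → ℕ → ℕ → Set
CongMod A B p m =
  ∃[ a ] ∃[ b ] (¬ (p ∣ b)) × ((A - B) * ℕ→ℚ b ≡ ℕ→ℚ (p ℕ.^ m) * (a / 1))

term : ℕ → ℚ
term k = ℕ→ℚ (4 ℕ.* k ℕ.+ 1) * pow (rising half k * invFact k) 4

{-# OPTIONS --safe #-}

-- Write n = pʳ = 2m+1 and Uₖ = (½)ₖ/k!.  A Whipple-type transformation of the truncated
-- series, and the evaluation n Uₘ ∑ⱼ Uⱼ Uₘ₋ⱼ/(2j+1) = 1, give the exact identity
--   ∑ₖ (4k+1) Uₖ⁴ - n = n Uₘ ∑_{j≤m} Uⱼ Uₘ₋ⱼ (n/(2j+1)) (εⱼ - 1),   εⱼ = ∏_{i≤j} (1 - (n/2i)²).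
-- The U's are p-integral and n/i ∈ p ℤ₍ₚ₎ for 0 < i < n.  Hence εⱼ - 1 ∈ p², and n/(2j+1) ∈ p
-- for j < m, so these summands lie in p³.  For j = m one has εₘ - 1 ≡ -¼ ∑_{i≤m} (n/i)² (mod p³),
-- and this sum lies in p³ by the symmetries i ↦ n - i and i ↦ 2i, because p ≠ 3.

module Submission where

open import Defs
open import Data.Empty using (⊥-elim)
open import Data.Nat as ℕ using (ℕ; zero; suc; z≤n; s≤s; _>_; _∸_; _^_; _!)
open import Data.Nat.Combinatorics.Specification using ([n∸k]!k!∣n!)
open import Data.Nat.DivMod using (_/_; _%_; m%n<n; m≡m%n+[m/n]*n; m*n/n≡m)
open import Data.Nat.Divisibility using (_∣_; divides; _∣?_; >⇒∤; m%n≡0⇒n∣m; hasNonTrivialDivisor)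
open import Data.Nat.Primality using (Prime; prime[2]; euclidsLemma)
import Data.Nat.Properties as ℕ
import Data.Nat.Tactic.RingSolver as ℕSolver
open import Data.Integer as ℤ using (ℤ)
import Data.Integer.Properties as ℤ
import Data.Integer.Tactic.RingSolver as ℤSolver
open import Data.Product using (∃-syntax; _,_; proj₁; proj₂)
open import Data.Rational using (ℚ; _+_; _*_; _-_; -_; 0ℚ; 1ℚ; ½; toℚᵘ) renaming (_/_ to _÷_)
open import Data.Rational.Properties
open import Data.Rational.Unnormalised as ℚᵘ using (mkℚᵘ; *≡*)
import Data.Rational.Unnormalised.Properties as ℚᵘ
open import Data.Sum using (inj₁; inj₂)
open import Relation.Binary.PropositionalEquality using (_≡_; refl; sym; trans; cong; cong₂; subst; module ≡-Reasoning)
open import Relation.Nullary using (¬_; yes; no)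
open import Relation.Nullary.Decidable.Core using (dec⇒maybe)
open import Tactic.RingSolver using (solve-∀)
open import Tactic.RingSolver.Core.AlmostCommutativeRing using (AlmostCommutativeRing; fromCommutativeRing)

open ≡-Reasoning

-- The summand at k = 0 is 1, so no bound on single summands can work: the modulus p^(3+r) becomes
-- accessible only once n = pʳ stands in front of an exact expression, of which divisibility by p³
-- remains to be shown. There 2j+1 may itself contain p up to the power r-1, so 1/(2j+1) is never
-- separated from n. The transformation is proved by induction on m. Its increment from m to m+1 is
-- (4k+1) Uₖ² times the Pfaff-Saalschütz sum ₃F₂(½, k+½, -k; 1, 1; 1) = Uₖ², with k = m+1; this is
-- where the fourth power comes from. That sum and the convolution ∑ⱼ Uⱼ Uₘ₋ⱼ/(2j+1) each satisfy a
-- first-order recurrence, proved by telescoping. The ring solver does not divide. Hence 1/(k+1) is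
-- an opaque `inv k`, and each identity between hypergeometric terms is a polynomial identity modulo
-- relations such as inv k * (k+1) = 1, whose cofactors are handed to `modulo`.

ℚ-ring : AlmostCommutativeRing _ _
ℚ-ring = fromCommutativeRing +-*-commutativeRing (λ x → dec⇒maybe (0ℚ ≟ x))

-- Integers and reciprocals inside ℚ.

ℤ→ℚ : ℤ → ℚ
ℤ→ℚ a = a ÷ 1

-- The shift by one keeps reciprocals total, without proofs of nonzeroness; below, `n * inv k`
-- stands for n/i with i = k+1.
inv : ℕ → ℚ
inv k = ℤ.+ 1 ÷ suc k

-- `_÷_` cancels a gcd and is stuck on variables; unnormalised fractions reduce equations in ℚ to
-- integer cross-multiplication.
toℚᵘ-÷ : ∀ a d → toℚᵘ (a ÷ suc d) ℚᵘ.≃ mkℚᵘ a d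
toℚᵘ-÷ a d = toℚᵘ-fromℚᵘ (mkℚᵘ a d)

ℤ→ℚ-+ : ∀ a b → ℤ→ℚ (a ℤ.+ b) ≡ ℤ→ℚ a + ℤ→ℚ b
ℤ→ℚ-+ a b = toℚᵘ-injective
  (ℚᵘ.≃-trans (toℚᵘ-÷ (a ℤ.+ b) 0)
  (ℚᵘ.≃-trans (*≡* (lemma a b))
  (ℚᵘ.≃-sym (ℚᵘ.≃-trans (toℚᵘ-homo-+ (ℤ→ℚ a) (ℤ→ℚ b))
                        (ℚᵘ.+-cong (toℚᵘ-÷ a 0) (toℚᵘ-÷ b 0))))))
  where
  lemma : ∀ a b → (a ℤ.+ b) ℤ.* ℤ.+ 1 ≡ (a ℤ.* ℤ.+ 1 ℤ.+ b ℤ.* ℤ.+ 1) ℤ.* ℤ.+ 1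
  lemma = ℤSolver.solve-∀

ℤ→ℚ-* : ∀ a b → ℤ→ℚ (a ℤ.* b) ≡ ℤ→ℚ a * ℤ→ℚ b
ℤ→ℚ-* a b = toℚᵘ-injective
  (ℚᵘ.≃-trans (toℚᵘ-÷ (a ℤ.* b) 0)
  (ℚᵘ.≃-sym (ℚᵘ.≃-trans (toℚᵘ-homo-* (ℤ→ℚ a) (ℤ→ℚ b))
                        (ℚᵘ.*-cong (toℚᵘ-÷ a 0) (toℚᵘ-÷ b 0)))))

ℕ→ℚ-+ : ∀ m n → ℕ→ℚ (m ℕ.+ n) ≡ ℕ→ℚ m + ℕ→ℚ n
ℕ→ℚ-+ m n = ℤ→ℚ-+ (ℤ.+ m) (ℤ.+ n)

ℕ→ℚ-* : ∀ m n → ℕ→ℚ (m ℕ.* n) ≡ ℕ→ℚ m * ℕ→ℚ n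
ℕ→ℚ-* m n = trans (cong ℤ→ℚ (ℤ.pos-* m n)) (ℤ→ℚ-* (ℤ.+ m) (ℤ.+ n))

ℕ→ℚ-suc : ∀ n → ℕ→ℚ (suc n) ≡ ℕ→ℚ n + 1ℚ
ℕ→ℚ-suc n = trans (ℕ→ℚ-+ 1 n) (+-comm 1ℚ (ℕ→ℚ n))

inv-suc : ∀ k → inv k * ℕ→ℚ (suc k) ≡ 1ℚ
inv-suc k = toℚᵘ-injective
  (ℚᵘ.≃-trans (toℚᵘ-homo-* (inv k) (ℕ→ℚ (suc k)))
  (ℚᵘ.≃-trans (ℚᵘ.*-cong (toℚᵘ-÷ (ℤ.+ 1) k) (toℚᵘ-÷ (ℤ.+ suc k) 0))
  (*≡* (lemma (ℤ.+ suc k)))))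
  where
  lemma : ∀ a → (ℤ.+ 1 ℤ.* a) ℤ.* ℤ.+ 1 ≡ ℤ.+ 1 ℤ.* (a ℤ.* ℤ.+ 1)
  lemma = ℤSolver.solve-∀

inv-+1 : ∀ k → inv k * (ℕ→ℚ k + 1ℚ) ≡ 1ℚ
inv-+1 k = trans (cong (inv k *_) (sym (ℕ→ℚ-suc k))) (inv-suc k)

-- The certificate c exhibits a - b as a multiple of the relation l = r.
modulo : ∀ {a b l r} c → l ≡ r → a ≡ b + c * (l - r) → a ≡ b
modulo {a} {b} {l} c refl eq = trans eq (lemma b c l)
  where
  lemma : ∀ b c l → b + c * (l - l) ≡ b
  lemma = solve-∀ ℚ-ring

-- Finite sums over half-open ranges.

∑ : ℕ → (ℕ → ℚ) → ℚ
∑ zero    f = 0ℚ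
∑ (suc n) f = ∑ n f + f n

∑-cong : ∀ n {f g : ℕ → ℚ} → (∀ k → k ℕ.< n → f k ≡ g k) → ∑ n f ≡ ∑ n g
∑-cong zero    eq = refl
∑-cong (suc n) eq = cong₂ _+_ (∑-cong n (λ k k<n → eq k (ℕ.m<n⇒m<1+n k<n))) (eq n ℕ.≤-refl)

∑-+ : ∀ n f g → ∑ n (λ k → f k + g k) ≡ ∑ n f + ∑ n g
∑-+ zero    f g = refl
∑-+ (suc n) f g = trans (cong (_+ (f n + g n)) (∑-+ n f g)) (lemma (∑ n f) (∑ n g) (f n) (g n))
  where
  lemma : ∀ a b c d → a + b + (c + d) ≡ a + c + (b + d)
  lemma = solve-∀ ℚ-ring

∑-*ˡ : ∀ c n f → ∑ n (λ k → c * f k) ≡ c * ∑ n f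
∑-*ˡ c zero    f = sym (*-zeroʳ c)
∑-*ˡ c (suc n) f = trans (cong (_+ c * f n) (∑-*ˡ c n f)) (sym (*-distribˡ-+ c (∑ n f) (f n)))

∑-front : ∀ n f → ∑ (suc n) f ≡ f 0 + ∑ n (λ k → f (suc k))
∑-front zero    f = +-comm 0ℚ (f 0)
∑-front (suc n) f = trans (cong (_+ f (suc n)) (∑-front n f)) (+-assoc (f 0) _ (f (suc n)))

∑-reverse : ∀ n f → ∑ n f ≡ ∑ n (λ k → f (n ℕ.∸ suc k))
∑-reverse zero    f = refl
∑-reverse (suc n) f = begin
  ∑ n f + f n                               ≡⟨ +-comm (∑ n f) (f n) ⟩
  f n + ∑ n f                               ≡⟨ cong (f n +_) (∑-reverse n f) ⟩
  f n + ∑ n (λ k → f (n ℕ.∸ suc k))         ≡⟨ ∑-front n (λ k → f (n ℕ.∸ k)) ⟨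
  ∑ (suc n) (λ k → f (n ℕ.∸ k))             ∎

∑-append : ∀ m n f → ∑ (n ℕ.+ m) f ≡ ∑ m f + ∑ n (λ k → f (k ℕ.+ m))
∑-append m zero    f = sym (+-identityʳ (∑ m f))
∑-append m (suc n) f = trans (cong (_+ f (n ℕ.+ m)) (∑-append m n f)) (+-assoc (∑ m f) _ _)

∑-pairs : ∀ m f → ∑ (m ℕ.+ m) f ≡ ∑ m (λ k → f (k ℕ.+ k)) + ∑ m (λ k → f (suc (k ℕ.+ k)))
∑-pairs zero    f = refl
∑-pairs (suc m) f = begin
  ∑ (m ℕ.+ suc m) f + f (m ℕ.+ suc m)
    ≡⟨ cong (λ j → ∑ j f + f j) (ℕ.+-suc m m) ⟩
  ∑ (m ℕ.+ m) f + f (m ℕ.+ m) + f (suc (m ℕ.+ m))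
    ≡⟨ cong (λ x → x + f (m ℕ.+ m) + f (suc (m ℕ.+ m))) (∑-pairs m f) ⟩
  _ ≡⟨ lemma (∑ m (λ k → f (k ℕ.+ k))) (∑ m (λ k → f (suc (k ℕ.+ k)))) (f (m ℕ.+ m)) (f (suc (m ℕ.+ m))) ⟩
  _ ∎
  where
  lemma : ∀ a b c d → a + b + c + d ≡ (a + c) + (b + d)
  lemma = solve-∀ ℚ-ring

sumTo≡∑ : ∀ n f → sumTo n f ≡ ∑ (suc n) f
sumTo≡∑ zero    f = sym (+-identityˡ (f 0))
sumTo≡∑ (suc n) f = cong (_+ f (suc n)) (sumTo≡∑ n f)

-- A Pfaff-Saalschütz evaluation.

U : ℕ → ℚ
U k = rising half k * invFact k

U-suc : ∀ k → U (suc k) ≡ U k * (½ + ℕ→ℚ k) * inv k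
U-suc k = lemma (rising half k) (½ + ℕ→ℚ k) (invFact k) (inv k)
  where
  lemma : ∀ a b c d → (a * b) * (c * d) ≡ (a * c) * b * d
  lemma = solve-∀ ℚ-ring

-- σ k j = (k+½)ⱼ(-k)ⱼ/j!² and q k j = (k+3/2)ⱼ(-k)ⱼ/j!², with rising factorials.
σ : ℕ → ℕ → ℚ
σ k zero    = 1ℚ
σ k (suc j) = σ k j * ((ℕ→ℚ k + ½ + ℕ→ℚ j) * (ℕ→ℚ j - ℕ→ℚ k)) * (inv j * inv j)

q : ℕ → ℕ → ℚ
q k zero    = 1ℚ
q k (suc j) = q k j * ((ℕ→ℚ k + 1ℚ + ½ + ℕ→ℚ j) * (ℕ→ℚ j - ℕ→ℚ k)) * (inv j * inv j)

-- Both sides share (-k)ⱼ/j!², and (k+½)ⱼ (k+½+j) = (k+½) (k+3/2)ⱼ.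
σ-q : ∀ k j → σ k j * (ℕ→ℚ k + ½ + ℕ→ℚ j) ≡ q k j * (ℕ→ℚ k + ½)
σ-q k zero    = lemma (ℕ→ℚ k)
  where
  lemma : ∀ K → 1ℚ * (K + ½ + 0ℚ) ≡ 1ℚ * (K + ½)
  lemma = solve-∀ ℚ-ring
σ-q k (suc j) = begin
  σ k (suc j) * (K + ½ + ℕ→ℚ (suc j))
    ≡⟨ cong (λ x → σ k (suc j) * (K + ½ + x)) (ℕ→ℚ-suc j) ⟩
  σ k j * ((K + ½ + J) * (J - K)) * (i * i) * (K + ½ + (J + 1ℚ))
    ≡⟨ lemma₁ K J (σ k j) i ⟩
  σ k j * (K + ½ + J) * ((K + 1ℚ + ½ + J) * (J - K) * (i * i))
    ≡⟨ cong (_* ((K + 1ℚ + ½ + J) * (J - K) * (i * i))) (σ-q k j) ⟩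
  q k j * (K + ½) * ((K + 1ℚ + ½ + J) * (J - K) * (i * i))
    ≡⟨ lemma₂ K J (q k j) i ⟩
  q k (suc j) * (K + ½) ∎
  where
  K = ℕ→ℚ k
  J = ℕ→ℚ j
  i = inv j
  lemma₁ : ∀ K J s i → s * ((K + ½ + J) * (J - K)) * (i * i) * (K + ½ + (J + 1ℚ))
         ≡ s * (K + ½ + J) * ((K + 1ℚ + ½ + J) * (J - K) * (i * i))
  lemma₁ = solve-∀ ℚ-ring
  lemma₂ : ∀ K J t i → t * (K + ½) * ((K + 1ℚ + ½ + J) * (J - K) * (i * i))
         ≡ t * ((K + 1ℚ + ½ + J) * (J - K)) * (i * i) * (K + ½)
  lemma₂ = solve-∀ ℚ-ring

σ-suc : ∀ k j → σ k (suc j) ≡ (ℕ→ℚ k + ½) * (ℕ→ℚ j - ℕ→ℚ k) * q k j * (inv j * inv j)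
σ-suc k j = begin
  σ k j * ((K + ½ + J) * (J - K)) * (i * i)  ≡⟨ lemma₁ (σ k j) (K + ½ + J) (J - K) (i * i) ⟩
  σ k j * (K + ½ + J) * ((J - K) * (i * i))  ≡⟨ cong (_* ((J - K) * (i * i))) (σ-q k j) ⟩
  q k j * (K + ½) * ((J - K) * (i * i))      ≡⟨ lemma₂ (q k j) (K + ½) (J - K) (i * i) ⟩
  (K + ½) * (J - K) * q k j * (i * i)        ∎
  where
  K = ℕ→ℚ k
  J = ℕ→ℚ j
  i = inv j
  lemma₁ : ∀ a b c d → a * (b * c) * d ≡ a * b * (c * d)
  lemma₁ = solve-∀ ℚ-ring
  lemma₂ : ∀ a b c d → a * b * (c * d) ≡ b * c * a * d
  lemma₂ = solve-∀ ℚ-ring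

-- (k+3/2)ⱼ occurs in both σ (k+1) and q k. Together with `σ-suc`, this makes the neighbours σ k and
-- σ (k+1) multiples of one quantity q k j, so that a recurrence in k becomes a polynomial identity.
σ-suc-suc : ∀ k j → σ (suc k) (suc j) ≡ - (ℕ→ℚ k + 1ℚ) * (ℕ→ℚ k + 1ℚ + ½ + ℕ→ℚ j) * q k j * (inv j * inv j)
σ-suc-suc k zero = trans (cong (λ x → 1ℚ * ((x + ½ + 0ℚ) * (0ℚ - x)) * (inv 0 * inv 0)) (ℕ→ℚ-suc k)) (lemma (ℕ→ℚ k) (inv 0))
  where
  lemma : ∀ K i → 1ℚ * ((K + 1ℚ + ½ + 0ℚ) * (0ℚ - (K + 1ℚ))) * (i * i) ≡ - (K + 1ℚ) * (K + 1ℚ + ½ + 0ℚ) * 1ℚ * (i * i)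
  lemma = solve-∀ ℚ-ring
σ-suc-suc k (suc j) = begin
  σ (suc k) (suc j) * ((ℕ→ℚ (suc k) + ½ + ℕ→ℚ (suc j)) * (ℕ→ℚ (suc j) - ℕ→ℚ (suc k))) * (i′ * i′)
    ≡⟨ cong₂ (λ x y → σ (suc k) (suc j) * ((x + ½ + y) * (y - x)) * (i′ * i′)) (ℕ→ℚ-suc k) (ℕ→ℚ-suc j) ⟩
  σ (suc k) (suc j) * ((K + 1ℚ + ½ + (J + 1ℚ)) * (J + 1ℚ - (K + 1ℚ))) * (i′ * i′)
    ≡⟨ cong (λ x → x * ((K + 1ℚ + ½ + (J + 1ℚ)) * (J + 1ℚ - (K + 1ℚ))) * (i′ * i′)) (σ-suc-suc k j) ⟩
  - (K + 1ℚ) * (K + 1ℚ + ½ + J) * q k j * (i * i) * ((K + 1ℚ + ½ + (J + 1ℚ)) * (J + 1ℚ - (K + 1ℚ))) * (i′ * i′)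
    ≡⟨ lemma K J (q k j) i i′ ⟩
  - (K + 1ℚ) * (K + 1ℚ + ½ + (J + 1ℚ)) * q k (suc j) * (i′ * i′)
    ≡⟨ cong (λ x → - (K + 1ℚ) * (K + 1ℚ + ½ + x) * q k (suc j) * (i′ * i′)) (ℕ→ℚ-suc j) ⟨
  - (K + 1ℚ) * (K + 1ℚ + ½ + ℕ→ℚ (suc j)) * q k (suc j) * (i′ * i′) ∎
  where
  K = ℕ→ℚ k
  J = ℕ→ℚ j
  i = inv j
  i′ = inv (suc j)
  lemma : ∀ K J t i i′ →
    - (K + 1ℚ) * (K + 1ℚ + ½ + J) * t * (i * i) * ((K + 1ℚ + ½ + (J + 1ℚ)) * (J + 1ℚ - (K + 1ℚ))) * (i′ * i′)
    ≡ - (K + 1ℚ) * (K + 1ℚ + ½ + (J + 1ℚ)) * (t * ((K + 1ℚ + ½ + J) * (J - K)) * (i * i)) * (i′ * i′)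
  lemma = solve-∀ ℚ-ring

q-vanish : ∀ k → q k (suc k) ≡ 0ℚ
q-vanish k = lemma (q k k) (ℕ→ℚ k + 1ℚ + ½ + ℕ→ℚ k) (ℕ→ℚ k) (inv k * inv k)
  where
  lemma : ∀ a b K c → a * (b * (K - K)) * c ≡ 0ℚ
  lemma = solve-∀ ℚ-ring

σ-vanish : ∀ k → σ k (suc k) ≡ 0ℚ
σ-vanish k = lemma (σ k k) (ℕ→ℚ k + ½ + ℕ→ℚ k) (ℕ→ℚ k) (inv k * inv k)
  where
  lemma : ∀ a b K c → a * (b * (K - K)) * c ≡ 0ℚ
  lemma = solve-∀ ℚ-ring

-- Zeilberger's algorithm supplies the antidifference on the right.
∑Uσ-telescope : ∀ k j →
  ∑ (suc j) (λ l → (ℕ→ℚ k + 1ℚ) * (ℕ→ℚ k + 1ℚ) * (U l * σ (suc k) l) - (ℕ→ℚ k + ½) * (ℕ→ℚ k + ½) * (U l * σ k l))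
  ≡ (ℕ→ℚ k + ℕ→ℚ k + 1ℚ + ½) * (q k j * ((ℕ→ℚ j + ½) * U j))
∑Uσ-telescope k zero = lemma (ℕ→ℚ k)
  where
  lemma : ∀ K → 0ℚ + ((K + 1ℚ) * (K + 1ℚ) * (1ℚ * 1ℚ * 1ℚ) - (K + ½) * (K + ½) * (1ℚ * 1ℚ * 1ℚ))
    ≡ (K + K + 1ℚ + ½) * (1ℚ * ((0ℚ + ½) * (1ℚ * 1ℚ)))
  lemma = solve-∀ ℚ-ring
∑Uσ-telescope k (suc j) = begin
  _ ≡⟨ cong (_+ (c₁ * (U (suc j) * σ (suc k) (suc j)) - c₀ * (U (suc j) * σ k (suc j)))) (∑Uσ-telescope k j) ⟩
  A + (c₁ * (U (suc j) * σ (suc k) (suc j)) - c₀ * (U (suc j) * σ k (suc j)))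
    ≡⟨ cong₂ (λ x y → A + (c₁ * (U (suc j) * x) - c₀ * (U (suc j) * y))) (σ-suc-suc k j) (σ-suc k j) ⟩
  A + (c₁ * (U (suc j) * (- (K + 1ℚ) * (K + 1ℚ + ½ + J) * q k j * (i * i)))
     - c₀ * (U (suc j) * ((K + ½) * (J - K) * q k j * (i * i))))
    ≡⟨ cong (λ x → A + (c₁ * (x * (- (K + 1ℚ) * (K + 1ℚ + ½ + J) * q k j * (i * i))) - c₀ * (x * ((K + ½) * (J - K) * q k j * (i * i))))) (U-suc j) ⟩
  A + (c₁ * ((U j * (½ + J) * i) * (- (K + 1ℚ) * (K + 1ℚ + ½ + J) * q k j * (i * i)))
     - c₀ * ((U j * (½ + J) * i) * ((K + ½) * (J - K) * q k j * (i * i))))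
    ≡⟨ modulo (certificate K J (q k j) (U j) i) (inv-+1 j) (lemma K J (q k j) (U j) i) ⟩
  (K + K + 1ℚ + ½) * (q k (suc j) * ((J + 1ℚ + ½) * (U j * (½ + J) * i)))
    ≡⟨ cong₂ (λ x y → (K + K + 1ℚ + ½) * (q k (suc j) * ((x + ½) * y))) (ℕ→ℚ-suc j) (U-suc j) ⟨
  (K + K + 1ℚ + ½) * (q k (suc j) * ((ℕ→ℚ (suc j) + ½) * U (suc j))) ∎
  where
  K = ℕ→ℚ k
  J = ℕ→ℚ j
  i = inv j
  c₁ = (K + 1ℚ) * (K + 1ℚ)
  c₀ = (K + ½) * (K + ½)
  A = (K + K + 1ℚ + ½) * (q k j * ((J + ½) * U j))
  -- Put x = i (J+1), which equals 1. Reciprocals enter to the third power, one from `U` and two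
  -- from `σ`, and the two sides differ by a multiple of x³ - 1 = (1 + x + x²)(x - 1).
  certificate : (K J t u i : ℚ) → ℚ
  certificate K J t u i =
    - ((K + K + 1ℚ + ½) * t * u * (½ + J) * (1ℚ + i * (J + 1ℚ) + i * (J + 1ℚ) * (i * (J + 1ℚ))))
  lemma : ∀ K J t u i →
    (K + K + 1ℚ + ½) * (t * ((J + ½) * u)) +
     ((K + 1ℚ) * (K + 1ℚ) * ((u * (½ + J) * i) * (- (K + 1ℚ) * (K + 1ℚ + ½ + J) * t * (i * i)))
     - (K + ½) * (K + ½) * ((u * (½ + J) * i) * ((K + ½) * (J - K) * t * (i * i))))
    ≡ (K + K + 1ℚ + ½) * (t * ((K + 1ℚ + ½ + J) * (J - K)) * (i * i) * ((J + 1ℚ + ½) * (u * (½ + J) * i)))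
      + - ((K + K + 1ℚ + ½) * t * u * (½ + J) * (1ℚ + i * (J + 1ℚ) + i * (J + 1ℚ) * (i * (J + 1ℚ)))) * (i * (J + 1ℚ) - 1ℚ)
  lemma = solve-∀ ℚ-ring

-- This is ₃F₂(½, k+½, -k; 1, 1; 1), a Saalschützian series. Calling it Sₖ, telescoping gives (k+1)²
-- Sₖ₊₁ = (k+½)² Sₖ, which is also the recurrence of Uₖ².
∑Uσ≡U² : ∀ k → ∑ (suc k) (λ j → U j * σ k j) ≡ U k * U k
∑Uσ≡U² zero = refl
∑Uσ≡U² (suc k) = begin
  X
    ≡⟨ modulo (- (X * (i * (K + 1ℚ) + 1ℚ))) (inv-+1 k) (lemma₁ X i (K + 1ℚ)) ⟩
  i * i * ((K + 1ℚ) * (K + 1ℚ) * X)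
    ≡⟨ cong (i * i *_) recurrence ⟩
  i * i * ((K + ½) * (K + ½) * (U k * U k))
    ≡⟨ lemma₂ (U k) K i ⟩
  (U k * (½ + K) * i) * (U k * (½ + K) * i)
    ≡⟨ cong₂ _*_ (U-suc k) (U-suc k) ⟨
  U (suc k) * U (suc k) ∎
  where
  K = ℕ→ℚ k
  i = inv k
  X = ∑ (suc (suc k)) (λ j → U j * σ (suc k) j)
  Y = ∑ (suc k) (λ j → U j * σ k j)
  c₁ = (K + 1ℚ) * (K + 1ℚ)
  c₀ = (K + ½) * (K + ½)
  lemma₁ : ∀ x i k → x ≡ i * i * (k * k * x) + - (x * (i * k + 1ℚ)) * (i * k - 1ℚ)
  lemma₁ = solve-∀ ℚ-ring
  lemma₂ : ∀ u k i → i * i * ((k + ½) * (k + ½) * (u * u)) ≡ (u * (½ + k) * i) * (u * (½ + k) * i)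
  lemma₂ = solve-∀ ℚ-ring
  lemma₃ : ∀ a b c → a - b * c ≡ a + - b * c
  lemma₃ = solve-∀ ℚ-ring
  -- The sum for σ k is taken one index too far, so that both sums have the range of the
  -- telescoping; the excess summand vanishes by `σ-vanish`, and the boundary value by `q-vanish`.
  difference : c₁ * X + - c₀ * ∑ (suc (suc k)) (λ j → U j * σ k j) ≡ (K + K + 1ℚ + ½) * (0ℚ * ((ℕ→ℚ (suc k) + ½) * U (suc k)))
  difference = begin
    c₁ * X + - c₀ * ∑ (suc (suc k)) (λ j → U j * σ k j)
      ≡⟨ cong₂ _+_ (∑-*ˡ c₁ (suc (suc k)) (λ j → U j * σ (suc k) j)) (∑-*ˡ (- c₀) (suc (suc k)) (λ j → U j * σ k j)) ⟨
    ∑ (suc (suc k)) (λ j → c₁ * (U j * σ (suc k) j)) + ∑ (suc (suc k)) (λ j → - c₀ * (U j * σ k j))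
      ≡⟨ ∑-+ (suc (suc k)) (λ j → c₁ * (U j * σ (suc k) j)) (λ j → - c₀ * (U j * σ k j)) ⟨
    ∑ (suc (suc k)) (λ j → c₁ * (U j * σ (suc k) j) + - c₀ * (U j * σ k j))
      ≡⟨ ∑-cong (suc (suc k)) (λ j _ → lemma₃ (c₁ * (U j * σ (suc k) j)) c₀ (U j * σ k j)) ⟨
    ∑ (suc (suc k)) (λ j → c₁ * (U j * σ (suc k) j) - c₀ * (U j * σ k j))
      ≡⟨ ∑Uσ-telescope k (suc k) ⟩
    (K + K + 1ℚ + ½) * (q k (suc k) * ((ℕ→ℚ (suc k) + ½) * U (suc k)))
      ≡⟨ cong (λ x → (K + K + 1ℚ + ½) * (x * ((ℕ→ℚ (suc k) + ½) * U (suc k)))) (q-vanish k) ⟩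
    (K + K + 1ℚ + ½) * (0ℚ * ((ℕ→ℚ (suc k) + ½) * U (suc k))) ∎
  lemma₄ : ∀ a b c → a ≡ (a + - b * c) + b * c
  lemma₄ = solve-∀ ℚ-ring
  lemma₅ : ∀ a b c y z → a * (0ℚ * b) + c * (y + z * 0ℚ) ≡ c * y
  lemma₅ = solve-∀ ℚ-ring
  recurrence : c₁ * X ≡ c₀ * (U k * U k)
  recurrence = begin
    c₁ * X
      ≡⟨ lemma₄ (c₁ * X) c₀ (Y + U (suc k) * σ k (suc k)) ⟩
    (c₁ * X + - c₀ * (Y + U (suc k) * σ k (suc k))) + c₀ * (Y + U (suc k) * σ k (suc k))
      ≡⟨ cong₂ (λ x y → x + c₀ * (Y + U (suc k) * y)) difference (σ-vanish k) ⟩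
    (K + K + 1ℚ + ½) * (0ℚ * ((ℕ→ℚ (suc k) + ½) * U (suc k))) + c₀ * (Y + U (suc k) * 0ℚ)
      ≡⟨ lemma₅ (K + K + 1ℚ + ½) ((ℕ→ℚ (suc k) + ½) * U (suc k)) c₀ Y (U (suc k)) ⟩
    c₀ * Y
      ≡⟨ cong (c₀ *_) (∑Uσ≡U² k) ⟩
    c₀ * (U k * U k) ∎

-- Whipple's transformation by induction on m.

w : ℕ → ℚ
w j = inv (j ℕ.+ j)

ℕ→ℚ-odd : ∀ j → ℕ→ℚ (suc (j ℕ.+ j)) ≡ ℕ→ℚ j + ℕ→ℚ j + 1ℚ
ℕ→ℚ-odd j = trans (ℕ→ℚ-suc (j ℕ.+ j)) (cong (_+ 1ℚ) (ℕ→ℚ-+ j j))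

w-odd : ∀ j → w j * (ℕ→ℚ j + ℕ→ℚ j + 1ℚ) ≡ 1ℚ
w-odd j = trans (cong (w j *_) (sym (ℕ→ℚ-odd j))) (inv-suc (j ℕ.+ j))

-- Both sides share (k+3/2)ⱼ/j!², and (k+1) (-k)ⱼ = (k+1-j) (-k-1)ⱼ.
q-σ : ∀ k j → q k j * (ℕ→ℚ k + 1ℚ) ≡ σ (suc k) j * (ℕ→ℚ k + 1ℚ - ℕ→ℚ j)
q-σ k zero = lemma (ℕ→ℚ k)
  where
  lemma : ∀ K → 1ℚ * (K + 1ℚ) ≡ 1ℚ * (K + 1ℚ - 0ℚ)
  lemma = solve-∀ ℚ-ring
q-σ k (suc j) = sym (begin
  σ (suc k) (suc j) * (K + 1ℚ - ℕ→ℚ (suc j))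
    ≡⟨ cong₂ (λ x y → x * (K + 1ℚ - y)) (σ-suc-suc k j) (ℕ→ℚ-suc j) ⟩
  - (K + 1ℚ) * (K + 1ℚ + ½ + J) * q k j * (i * i) * (K + 1ℚ - (J + 1ℚ))
    ≡⟨ lemma K J (q k j) i ⟩
  q k (suc j) * (K + 1ℚ) ∎)
  where
  K = ℕ→ℚ k
  J = ℕ→ℚ j
  i = inv j
  lemma : ∀ K J t i → - (K + 1ℚ) * (K + 1ℚ + ½ + J) * t * (i * i) * (K + 1ℚ - (J + 1ℚ))
    ≡ t * ((K + 1ℚ + ½ + J) * (J - K)) * (i * i) * (K + 1ℚ)
  lemma = solve-∀ ℚ-ring

term-U : ∀ k → term k ≡ (ℕ→ℚ k + ℕ→ℚ k + (ℕ→ℚ k + ℕ→ℚ k) + 1ℚ) * (U k * U k * (U k * U k))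
term-U k = begin
  ℕ→ℚ (4 ℕ.* k ℕ.+ 1) * pow (U k) 4        ≡⟨ cong (_* pow (U k) 4) (ℕ→ℚ-+ (4 ℕ.* k) 1) ⟩
  (ℕ→ℚ (4 ℕ.* k) + 1ℚ) * pow (U k) 4       ≡⟨ cong (λ x → (x + 1ℚ) * pow (U k) 4) (ℕ→ℚ-* 4 k) ⟩
  (ℕ→ℚ 4 * ℕ→ℚ k + 1ℚ) * pow (U k) 4       ≡⟨ lemma (ℕ→ℚ k) (U k) ⟩
  _ ∎
  where
  lemma : ∀ K u → (ℕ→ℚ 4 * K + 1ℚ) * (1ℚ * u * u * u * u) ≡ (K + K + (K + K) + 1ℚ) * (u * u * (u * u))
  lemma = solve-∀ ℚ-ring

-- Both values of `q` are rational multiples of σ (m+1) j, and N Uₘ = 2(m+1) Uₘ₊₁. With a = m+1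
-- everything comes down to (2a+1)(2a+1+2j) - 4a(a-j) = (4a+1)(2j+1), whose factor 2j+1 cancels
-- `w j`.
Uq-difference : ∀ m j → let N = ℕ→ℚ m + ℕ→ℚ m + 1ℚ ; N′ = ℕ→ℚ m + ℕ→ℚ m + 1ℚ + 1ℚ + 1ℚ in
  N′ * N′ * (U (suc m) * U (suc m)) * (U j * q (suc m) j * w j)
  ≡ N * N * (U m * U m) * (U j * q m j * w j)
    + (ℕ→ℚ m + ℕ→ℚ m + (ℕ→ℚ m + ℕ→ℚ m) + ℕ→ℚ 5) * (U (suc m) * U (suc m)) * (U j * σ (suc m) j)
Uq-difference m j =
  modulo (- (ℕ→ℚ 2 * N′ * (u′ * u′) * v * z)) σ-q′
  (modulo (ℕ→ℚ 4 * (M + 1ℚ) * (u′ * u′) * v * z) (sym (q-σ m j))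
  (modulo ((M + M + (M + M) + ℕ→ℚ 5) * (u′ * u′) * (v * σ (suc m) j)) (w-odd j)
  -- The relation enters squared, as 4(m+1)² Uₘ₊₁² = N² Uₘ²; the cofactor is the other factor of a
  -- difference of squares.
  (modulo (ℕ→ℚ 4 * (v * q m j * z) * (u′ * (M + 1ℚ) + (½ + M) * U m)) U-ratio
  (lemma M J (U m) u′ v (q (suc m) j) (q m j) (σ (suc m) j) z))))
  where
  M = ℕ→ℚ m
  J = ℕ→ℚ j
  N′ = M + M + 1ℚ + 1ℚ + 1ℚ
  i = inv m
  u′ = U (suc m)
  v = U j
  z = w j
  σ-q′ : σ (suc m) j * (M + 1ℚ + ½ + J) ≡ q (suc m) j * (M + 1ℚ + ½)
  σ-q′ = subst (λ x → σ (suc m) j * (x + ½ + J) ≡ q (suc m) j * (x + ½)) (ℕ→ℚ-suc m) (σ-q (suc m) j)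
  U-ratio : u′ * (M + 1ℚ) ≡ (½ + M) * U m
  U-ratio = trans (cong (_* (M + 1ℚ)) (U-suc m)) (modulo (U m * (½ + M)) (inv-+1 m) (ring-lemma (U m) M i))
    where
    ring-lemma : ∀ u M i → u * (½ + M) * i * (M + 1ℚ) ≡ (½ + M) * u + u * (½ + M) * (i * (M + 1ℚ) - 1ℚ)
    ring-lemma = solve-∀ ℚ-ring
  lemma : ∀ M J u u′ v q′ q s z →
    (M + M + 1ℚ + 1ℚ + 1ℚ) * (M + M + 1ℚ + 1ℚ + 1ℚ) * (u′ * u′) * (v * q′ * z)
    ≡ (M + M + 1ℚ) * (M + M + 1ℚ) * (u * u) * (v * q * z)
      + (M + M + (M + M) + ℕ→ℚ 5) * (u′ * u′) * (v * s)
      + - (ℕ→ℚ 2 * (M + M + 1ℚ + 1ℚ + 1ℚ) * (u′ * u′) * v * z) * (s * (M + 1ℚ + ½ + J) - q′ * (M + 1ℚ + ½))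
      + (ℕ→ℚ 4 * (M + 1ℚ) * (u′ * u′) * v * z) * (s * (M + 1ℚ - J) - q * (M + 1ℚ))
      + (M + M + (M + M) + ℕ→ℚ 5) * (u′ * u′) * (v * s) * (z * (J + J + 1ℚ) - 1ℚ)
      + (ℕ→ℚ 4 * (v * q * z) * (u′ * (M + 1ℚ) + (½ + M) * u)) * (u′ * (M + 1ℚ) - (½ + M) * u)
  lemma = solve-∀ ℚ-ring

-- The case a = b = c = d = ½ of Whipple's ₇F₆ → ₄F₃ transformation of a truncated series.
∑term≡∑Uq : ∀ m → let N = ℕ→ℚ m + ℕ→ℚ m + 1ℚ in
  ∑ (suc m) term ≡ N * N * (U m * U m) * ∑ (suc m) (λ j → U j * q m j * w j)
∑term≡∑Uq zero    = refl
∑term≡∑Uq (suc m) = sym (begin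
  (ℕ→ℚ (suc m) + ℕ→ℚ (suc m) + 1ℚ) * (ℕ→ℚ (suc m) + ℕ→ℚ (suc m) + 1ℚ) * (u′ * u′) * ∑ (suc (suc m)) (Uq (suc m))
    ≡⟨ cong (λ x → (x + x + 1ℚ) * (x + x + 1ℚ) * (u′ * u′) * ∑ (suc (suc m)) (Uq (suc m))) (ℕ→ℚ-suc m) ⟩
  (M + 1ℚ + (M + 1ℚ) + 1ℚ) * (M + 1ℚ + (M + 1ℚ) + 1ℚ) * (u′ * u′) * ∑ (suc (suc m)) (Uq (suc m))
    ≡⟨ lemma₁ M u′ (∑ (suc (suc m)) (Uq (suc m))) ⟩
  c′ * ∑ (suc (suc m)) (Uq (suc m))
    ≡⟨ ∑-*ˡ c′ (suc (suc m)) (Uq (suc m)) ⟨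
  ∑ (suc (suc m)) (λ j → c′ * Uq (suc m) j)
    ≡⟨ ∑-cong (suc (suc m)) (λ j _ → Uq-difference m j) ⟩
  ∑ (suc (suc m)) (λ j → c * Uq m j + g * (U j * σ (suc m) j))
    ≡⟨ ∑-+ (suc (suc m)) (λ j → c * Uq m j) (λ j → g * (U j * σ (suc m) j)) ⟩
  ∑ (suc (suc m)) (λ j → c * Uq m j) + ∑ (suc (suc m)) (λ j → g * (U j * σ (suc m) j))
    ≡⟨ cong₂ _+_ (∑-*ˡ c (suc (suc m)) (Uq m)) (∑-*ˡ g (suc (suc m)) (λ j → U j * σ (suc m) j)) ⟩
  c * (∑ (suc m) (Uq m) + U (suc m) * q m (suc m) * w (suc m)) + g * ∑ (suc (suc m)) (λ j → U j * σ (suc m) j)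
    ≡⟨ cong₂ (λ x y → c * (∑ (suc m) (Uq m) + U (suc m) * x * w (suc m)) + g * y) (q-vanish m) (∑Uσ≡U² (suc m)) ⟩
  c * (∑ (suc m) (Uq m) + U (suc m) * 0ℚ * w (suc m)) + g * (u′ * u′)
    ≡⟨ lemma₂ c (∑ (suc m) (Uq m)) (U (suc m)) (w (suc m)) M u′ ⟩
  c * ∑ (suc m) (Uq m) + (M + 1ℚ + (M + 1ℚ) + (M + 1ℚ + (M + 1ℚ)) + 1ℚ) * (u′ * u′ * (u′ * u′))
    ≡⟨ cong₂ (λ x y → x + (y + y + (y + y) + 1ℚ) * (u′ * u′ * (u′ * u′))) (∑term≡∑Uq m) (ℕ→ℚ-suc m) ⟨
  ∑ (suc m) term + (ℕ→ℚ (suc m) + ℕ→ℚ (suc m) + (ℕ→ℚ (suc m) + ℕ→ℚ (suc m)) + 1ℚ) * (u′ * u′ * (u′ * u′))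
    ≡⟨ cong (∑ (suc m) term +_) (term-U (suc m)) ⟨
  ∑ (suc m) term + term (suc m) ∎)
  where
  M = ℕ→ℚ m
  u′ = U (suc m)
  Uq : ℕ → ℕ → ℚ
  Uq m j = U j * q m j * w j
  c = (M + M + 1ℚ) * (M + M + 1ℚ) * (U m * U m)
  c′ = (M + M + 1ℚ + 1ℚ + 1ℚ) * (M + M + 1ℚ + 1ℚ + 1ℚ) * (u′ * u′)
  g = (M + M + (M + M) + ℕ→ℚ 5) * (u′ * u′)
  lemma₁ : ∀ M u x → (M + 1ℚ + (M + 1ℚ) + 1ℚ) * (M + 1ℚ + (M + 1ℚ) + 1ℚ) * (u * u) * x
    ≡ (M + M + 1ℚ + 1ℚ + 1ℚ) * (M + M + 1ℚ + 1ℚ + 1ℚ) * (u * u) * x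
  lemma₁ = solve-∀ ℚ-ring
  lemma₂ : ∀ c x y z M u → c * (x + y * 0ℚ * z) + (M + M + (M + M) + ℕ→ℚ 5) * (u * u) * (u * u)
    ≡ c * x + (M + 1ℚ + (M + 1ℚ) + (M + 1ℚ + (M + 1ℚ)) + 1ℚ) * (u * u * (u * u))
  lemma₂ = solve-∀ ℚ-ring

-- The factors 1 - (n/2i)² in the transformed summand.

ε : ℚ → ℕ → ℚ
ε h zero    = 1ℚ
ε h (suc j) = ε h j * (1ℚ - h * inv j * (h * inv j))

-- With h = m+½, the product over i ≤ j of (h-i)/(m+1-i) is Uₘ/Uₘ₋ⱼ, and that of (h+i)(i-1-m)/i² is
-- q m j. Multiplied, they leave -(h+i)(h-i)/i² = 1 - (h/i)². The argument `d` is m - j.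
qU≡Uε : ∀ {m} j d → d ℕ.+ j ≡ m → q m j * U m ≡ U d * ε (ℕ→ℚ m + ½) j
qU≡Uε {m} zero    d eq = begin
  1ℚ * U m   ≡⟨ *-comm 1ℚ (U m) ⟩
  U m * 1ℚ   ≡⟨ cong (λ x → U x * 1ℚ) (trans (sym eq) (ℕ.+-identityʳ d)) ⟩
  U d * 1ℚ   ∎
qU≡Uε {m} (suc j) d eq = begin
  q m j * ((M + 1ℚ + ½ + J) * (J - M)) * (i * i) * U m
    ≡⟨ lemma₁ (q m j) ((M + 1ℚ + ½ + J) * (J - M)) (i * i) (U m) ⟩
  q m j * U m * (((M + 1ℚ + ½ + J) * (J - M)) * (i * i))
    ≡⟨ cong (_* (((M + 1ℚ + ½ + J) * (J - M)) * (i * i))) (qU≡Uε j (suc d) (trans (sym (ℕ.+-suc d j)) eq)) ⟩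
  U (suc d) * E * (((M + 1ℚ + ½ + J) * (J - M)) * (i * i))
    ≡⟨ cong₂ (λ u x → u * E * (((x + 1ℚ + ½ + J) * (J - x)) * (i * i))) (U-suc d) M≡ ⟩
  U d * (½ + D) * i′ * E * (((D + J + 1ℚ + 1ℚ + ½ + J) * (J - (D + J + 1ℚ))) * (i * i))
    ≡⟨ modulo (U d * E * (i * (J + 1ℚ) + 1ℚ)) (inv-+1 j)
      (modulo (- (U d * E * (½ + D) * (D + J + 1ℚ + 1ℚ + ½ + J) * (i * i))) (inv-+1 d)
      (lemma₂ (U d) E D J i i′)) ⟩
  U d * (E * (1ℚ - (D + J + 1ℚ + ½) * i * ((D + J + 1ℚ + ½) * i)))
    ≡⟨ cong (λ x → U d * (E * (1ℚ - (x + ½) * i * ((x + ½) * i)))) M≡ ⟨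
  U d * (E * (1ℚ - (M + ½) * i * ((M + ½) * i))) ∎
  where
  M = ℕ→ℚ m
  J = ℕ→ℚ j
  D = ℕ→ℚ d
  i = inv j
  i′ = inv d
  E = ε (M + ½) j
  M≡ : M ≡ D + J + 1ℚ
  M≡ = begin
    ℕ→ℚ m                ≡⟨ cong ℕ→ℚ (trans (sym (ℕ.+-suc d j)) eq) ⟨
    ℕ→ℚ (suc (d ℕ.+ j))  ≡⟨ ℕ→ℚ-suc (d ℕ.+ j) ⟩
    ℕ→ℚ (d ℕ.+ j) + 1ℚ   ≡⟨ cong (_+ 1ℚ) (ℕ→ℚ-+ d j) ⟩
    D + J + 1ℚ           ∎
  lemma₁ : ∀ a b c d → a * b * c * d ≡ a * d * (b * c)
  lemma₁ = solve-∀ ℚ-ring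
  lemma₂ : ∀ u E D J i i′ →
    u * (½ + D) * i′ * E * (((D + J + 1ℚ + 1ℚ + ½ + J) * (J - (D + J + 1ℚ))) * (i * i))
    ≡ u * (E * (1ℚ - (D + J + 1ℚ + ½) * i * ((D + J + 1ℚ + ½) * i)))
      + u * E * (i * (J + 1ℚ) + 1ℚ) * (i * (J + 1ℚ) - 1ℚ)
      + - (u * E * (½ + D) * (D + J + 1ℚ + 1ℚ + ½ + J) * (i * i)) * (i′ * (D + 1ℚ) - 1ℚ)
  lemma₂ = solve-∀ ℚ-ring

-- The convolution of Uⱼ/(2j+1) with Uⱼ, and the exact identity.

V : ℕ → ℚ
V m = ∑ (suc m) (λ j → U j * U (m ℕ.∸ j) * w j)

-- Summand l of (2m+3) V (m+1) - (2m+2) V m. It is meaningful for l ≤ m only, because `m ∸ l`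
-- truncates.
V-difference : ℕ → ℕ → ℚ
V-difference m l = (ℕ→ℚ m + ℕ→ℚ m + ℕ→ℚ 3) * (U l * U (suc m ℕ.∸ l) * w l)
                 + - (ℕ→ℚ m + ℕ→ℚ m + ℕ→ℚ 2) * (U l * U (m ℕ.∸ l) * w l)

-- Again the antidifference on the right comes from Zeilberger's algorithm.
V-telescope : ∀ {m} j d → d ℕ.+ j ≡ m →
  (ℕ→ℚ m + 1ℚ) * ∑ (suc j) (V-difference m) ≡ - ((½ + ℕ→ℚ j) * U j * U d)
V-telescope {m} zero d eq = begin
  (M + 1ℚ) * (0ℚ + ((M + M + ℕ→ℚ 3) * (1ℚ * U (suc m) * 1ℚ) + - (M + M + ℕ→ℚ 2) * (1ℚ * U m * 1ℚ)))
    ≡⟨ cong (λ x → (M + 1ℚ) * (0ℚ + ((M + M + ℕ→ℚ 3) * (1ℚ * x * 1ℚ) + - (M + M + ℕ→ℚ 2) * (1ℚ * U m * 1ℚ)))) (U-suc m) ⟩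
  (M + 1ℚ) * (0ℚ + ((M + M + ℕ→ℚ 3) * (1ℚ * (U m * (½ + M) * inv m) * 1ℚ) + - (M + M + ℕ→ℚ 2) * (1ℚ * U m * 1ℚ)))
    ≡⟨ modulo (U m * (M + M + ℕ→ℚ 3) * (½ + M)) (inv-+1 m) (lemma M (U m) (inv m)) ⟩
  - ((½ + 0ℚ) * 1ℚ * U m)
    ≡⟨ cong (λ x → - ((½ + 0ℚ) * 1ℚ * U x)) (trans (sym eq) (ℕ.+-identityʳ d)) ⟩
  - ((½ + 0ℚ) * 1ℚ * U d) ∎
  where
  M = ℕ→ℚ m
  lemma : ∀ M u i → (M + 1ℚ) * (0ℚ + ((M + M + ℕ→ℚ 3) * (1ℚ * (u * (½ + M) * i) * 1ℚ) + - (M + M + ℕ→ℚ 2) * (1ℚ * u * 1ℚ)))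
    ≡ - ((½ + 0ℚ) * 1ℚ * u) + u * (M + M + ℕ→ℚ 3) * (½ + M) * (i * (M + 1ℚ) - 1ℚ)
  lemma = solve-∀ ℚ-ring
V-telescope {m} (suc j) d eq = begin
  (M + 1ℚ) * (∑ (suc j) (V-difference m) + V-difference m (suc j))
    ≡⟨ *-distribˡ-+ (M + 1ℚ) (∑ (suc j) (V-difference m)) (V-difference m (suc j)) ⟩
  (M + 1ℚ) * ∑ (suc j) (V-difference m) + (M + 1ℚ) * V-difference m (suc j)
    ≡⟨ cong (_+ (M + 1ℚ) * V-difference m (suc j)) (V-telescope j (suc d) 1+d+j≡m) ⟩
  - ((½ + J) * U j * U (suc d)) + (M + 1ℚ) * ((M + M + ℕ→ℚ 3) * (U (suc j) * U (m ℕ.∸ j) * z) + - (M + M + ℕ→ℚ 2) * (U (suc j) * U (m ℕ.∸ suc j) * z))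
    ≡⟨ cong₂ (λ a b → - ((½ + J) * U j * U (suc d)) + (M + 1ℚ) * ((M + M + ℕ→ℚ 3) * (U (suc j) * U a * z) + - (M + M + ℕ→ℚ 2) * (U (suc j) * U b * z))) m∸j m∸1+j ⟩
  - ((½ + J) * U j * U (suc d)) + (M + 1ℚ) * ((M + M + ℕ→ℚ 3) * (U (suc j) * U (suc d) * z) + - (M + M + ℕ→ℚ 2) * (U (suc j) * U d * z))
    ≡⟨ cong₂ (λ a b → - ((½ + J) * U j * b) + (M + 1ℚ) * ((M + M + ℕ→ℚ 3) * (a * b * z) + - (M + M + ℕ→ℚ 2) * (a * U d * z))) (U-suc j) (U-suc d) ⟩
  expr M
    ≡⟨ cong expr M≡ ⟩
  expr (D + J + 1ℚ)
    ≡⟨ modulo (U j * U d * (½ + J) * (- 1ℚ - ½ * i + (D + J + 1ℚ + 1ℚ) * i * (z * (D + J + 1ℚ + (D + J + 1ℚ) + ℕ→ℚ 2)))) (inv-+1 d)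
      (modulo (U j * U d * (½ + J) * (1ℚ - ½ * i′)) (inv-+1 j)
      (modulo (- (U j * U d * (½ + J) * ((D + J + 1ℚ + 1ℚ) * i * (½ * i′)))) z-inverse
      (lemma (U j) (U d) D J i i′ z))) ⟩
  - ((½ + (J + 1ℚ)) * (U j * (½ + J) * i) * U d)
    ≡⟨ cong₂ (λ x y → - ((½ + x) * y * U d)) (ℕ→ℚ-suc j) (U-suc j) ⟨
  - ((½ + ℕ→ℚ (suc j)) * U (suc j) * U d) ∎
  where
  M = ℕ→ℚ m
  J = ℕ→ℚ j
  D = ℕ→ℚ d
  i = inv j
  i′ = inv d
  z = w (suc j)
  expr : ℚ → ℚ
  expr M = - ((½ + J) * U j * (U d * (½ + D) * i′))
    + (M + 1ℚ) * ((M + M + ℕ→ℚ 3) * ((U j * (½ + J) * i) * (U d * (½ + D) * i′) * z)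
                  + - (M + M + ℕ→ℚ 2) * ((U j * (½ + J) * i) * U d * z))
  1+d+j≡m : suc d ℕ.+ j ≡ m
  1+d+j≡m = trans (sym (ℕ.+-suc d j)) eq
  m∸j : m ℕ.∸ j ≡ suc d
  m∸j = trans (cong (ℕ._∸ j) (sym 1+d+j≡m)) (ℕ.m+n∸n≡m (suc d) j)
  m∸1+j : m ℕ.∸ suc j ≡ d
  m∸1+j = trans (cong (ℕ._∸ suc j) (sym eq)) (ℕ.m+n∸n≡m d (suc j))
  M≡ : M ≡ D + J + 1ℚ
  M≡ = begin
    ℕ→ℚ m                ≡⟨ cong ℕ→ℚ 1+d+j≡m ⟨
    ℕ→ℚ (suc (d ℕ.+ j))  ≡⟨ ℕ→ℚ-suc (d ℕ.+ j) ⟩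
    ℕ→ℚ (d ℕ.+ j) + 1ℚ   ≡⟨ cong (_+ 1ℚ) (ℕ→ℚ-+ d j) ⟩
    D + J + 1ℚ           ∎
  z-inverse : z * (J + 1ℚ + (J + 1ℚ) + 1ℚ) ≡ 1ℚ
  z-inverse = subst (λ x → z * (x + x + 1ℚ) ≡ 1ℚ) (ℕ→ℚ-suc j) (w-odd (suc j))
  lemma : ∀ a b D J i i′ z →
    - ((½ + J) * a * (b * (½ + D) * i′))
    + (D + J + 1ℚ + 1ℚ) * ((D + J + 1ℚ + (D + J + 1ℚ) + ℕ→ℚ 3) * ((a * (½ + J) * i) * (b * (½ + D) * i′) * z)
                  + - (D + J + 1ℚ + (D + J + 1ℚ) + ℕ→ℚ 2) * ((a * (½ + J) * i) * b * z))
    ≡ - ((½ + (J + 1ℚ)) * (a * (½ + J) * i) * b)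
      + a * b * (½ + J) * (- 1ℚ - ½ * i + (D + J + 1ℚ + 1ℚ) * i * (z * (D + J + 1ℚ + (D + J + 1ℚ) + ℕ→ℚ 2))) * (i′ * (D + 1ℚ) - 1ℚ)
      + a * b * (½ + J) * (1ℚ - ½ * i′) * (i * (J + 1ℚ) - 1ℚ)
      + - (a * b * (½ + J) * ((D + J + 1ℚ + 1ℚ) * i * (½ * i′))) * (z * (J + 1ℚ + (J + 1ℚ) + 1ℚ) - 1ℚ)
  lemma = solve-∀ ℚ-ring

-- Telescoping stops at l = m. The remaining summand j = m+1 of V (m+1) contributes (2m+3) w (m+1)
-- Uₘ₊₁ = Uₘ₊₁, which cancels the boundary value -(½+m) Uₘ/(m+1).
V-suc : ∀ m → (ℕ→ℚ m + ℕ→ℚ m + ℕ→ℚ 3) * V (suc m) ≡ (ℕ→ℚ m + ℕ→ℚ m + ℕ→ℚ 2) * V m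
V-suc m = begin
  c₃ * (A + U (suc m) * U (suc m ℕ.∸ suc m) * z)
    ≡⟨ cong (λ x → c₃ * (A + U (suc m) * U x * z)) (ℕ.n∸n≡0 m) ⟩
  c₃ * (A + U (suc m) * 1ℚ * z)
    ≡⟨ cong (λ x → c₃ * (A + x * 1ℚ * z)) (U-suc m) ⟩
  c₃ * (A + U m * (½ + M) * i * 1ℚ * z)
    ≡⟨ modulo i scaled
      (modulo (- (c₃ * A + - c₂ * V m)) (inv-+1 m)
      (modulo (U m * (½ + M) * i) z-inverse
      (lemma₁ M A (V m) (U m) i z))) ⟩
  c₂ * V m ∎
  where
  M = ℕ→ℚ m
  i = inv m
  z = w (suc m)
  c₃ = M + M + ℕ→ℚ 3
  c₂ = M + M + ℕ→ℚ 2
  A = ∑ (suc m) (λ j → U j * U (suc m ℕ.∸ j) * w j)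
  z-inverse : z * (M + 1ℚ + (M + 1ℚ) + 1ℚ) ≡ 1ℚ
  z-inverse = subst (λ x → z * (x + x + 1ℚ) ≡ 1ℚ) (ℕ→ℚ-suc m) (w-odd (suc m))
  scaled : (M + 1ℚ) * (c₃ * A + - c₂ * V m) ≡ - ((½ + M) * U m * 1ℚ)
  scaled = begin
    (M + 1ℚ) * (c₃ * A + - c₂ * V m)
      ≡⟨ cong₂ (λ x y → (M + 1ℚ) * (x + y)) (∑-*ˡ c₃ (suc m) _) (∑-*ˡ (- c₂) (suc m) _) ⟨
    (M + 1ℚ) * (∑ (suc m) (λ j → c₃ * (U j * U (suc m ℕ.∸ j) * w j)) + ∑ (suc m) (λ j → - c₂ * (U j * U (m ℕ.∸ j) * w j)))
      ≡⟨ cong ((M + 1ℚ) *_) (∑-+ (suc m) _ _) ⟨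
    (M + 1ℚ) * ∑ (suc m) (V-difference m)
      ≡⟨ V-telescope m 0 refl ⟩
    - ((½ + M) * U m * 1ℚ) ∎
  lemma₁ : ∀ M A V u i z →
    (M + M + ℕ→ℚ 3) * (A + u * (½ + M) * i * 1ℚ * z)
    ≡ (M + M + ℕ→ℚ 2) * V
      + i * ((M + 1ℚ) * ((M + M + ℕ→ℚ 3) * A + - (M + M + ℕ→ℚ 2) * V) - - ((½ + M) * u * 1ℚ))
      + - ((M + M + ℕ→ℚ 3) * A + - (M + M + ℕ→ℚ 2) * V) * (i * (M + 1ℚ) - 1ℚ)
      + u * (½ + M) * i * (z * (M + 1ℚ + (M + 1ℚ) + 1ℚ) - 1ℚ)
  lemma₁ = solve-∀ ℚ-ring

-- In generating functions, V m is the coefficient of xᵐ in (1-x)^(-½) · arcsin(√x)/√x, namely 4ᵐ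
-- m!²/(2m+1)!. The proof compares the first-order recurrences of U and V.
nUV≡1 : ∀ m → (ℕ→ℚ m + ℕ→ℚ m + 1ℚ) * (U m * V m) ≡ 1ℚ
nUV≡1 zero    = refl
nUV≡1 (suc m) = begin
  (ℕ→ℚ (suc m) + ℕ→ℚ (suc m) + 1ℚ) * (U (suc m) * V (suc m))
    ≡⟨ cong₂ (λ x u → (x + x + 1ℚ) * (u * V (suc m))) (ℕ→ℚ-suc m) (U-suc m) ⟩
  (M + 1ℚ + (M + 1ℚ) + 1ℚ) * (U m * (½ + M) * i * V (suc m))
    ≡⟨ modulo (U m * (½ + M) * i) (V-suc m)
      (modulo ((M + M + 1ℚ) * (U m * V m)) (inv-+1 m)
      (modulo 1ℚ (nUV≡1 m)
      (lemma M (U m) i (V m) (V (suc m))))) ⟩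
  1ℚ ∎
  where
  M = ℕ→ℚ m
  i = inv m
  lemma : ∀ M u i V V′ → (M + 1ℚ + (M + 1ℚ) + 1ℚ) * (u * (½ + M) * i * V′)
    ≡ 1ℚ + u * (½ + M) * i * ((M + M + ℕ→ℚ 3) * V′ - (M + M + ℕ→ℚ 2) * V)
      + (M + M + 1ℚ) * (u * V) * (i * (M + 1ℚ) - 1ℚ)
      + 1ℚ * ((M + M + 1ℚ) * (u * V) - 1ℚ)
  lemma = solve-∀ ℚ-ring

-- Writing the subtracted n as n (n Uₘ V m) makes it the transformed sum with every εⱼ replaced by
-- 1, so only εⱼ - 1 survives.
∑term-n : ∀ m → let n = ℕ→ℚ m + ℕ→ℚ m + 1ℚ in
  ∑ (suc m) term - n ≡ n * (U m * ∑ (suc m) (λ j → U j * U (m ℕ.∸ j) * (n * w j * (ε (ℕ→ℚ m + ½) j - 1ℚ))))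
∑term-n m = begin
  ∑ (suc m) term - n
    ≡⟨ cong (_- n) (∑term≡∑Uq m) ⟩
  n * n * (U m * U m) * ∑ (suc m) (λ j → U j * q m j * w j) - n
    ≡⟨ modulo n (nUV≡1 m) (lemma₁ n (U m) (∑ (suc m) (λ j → U j * q m j * w j)) (V m)) ⟩
  n * (U m * (n * U m * ∑ (suc m) (λ j → U j * q m j * w j) + - n * V m))
    ≡⟨ cong₂ (λ x y → n * (U m * (x + y))) (∑-*ˡ (n * U m) (suc m) _) (∑-*ˡ (- n) (suc m) _) ⟨
  n * (U m * (∑ (suc m) (λ j → n * U m * (U j * q m j * w j)) + ∑ (suc m) (λ j → - n * (U j * U (m ℕ.∸ j) * w j))))
    ≡⟨ cong (λ x → n * (U m * x)) (∑-+ (suc m) _ _) ⟨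
  n * (U m * ∑ (suc m) (λ j → n * U m * (U j * q m j * w j) + - n * (U j * U (m ℕ.∸ j) * w j)))
    ≡⟨ cong (λ x → n * (U m * x)) (∑-cong (suc m) summand) ⟩
  n * (U m * ∑ (suc m) (λ j → U j * U (m ℕ.∸ j) * (n * w j * (ε (ℕ→ℚ m + ½) j - 1ℚ)))) ∎
  where
  n = ℕ→ℚ m + ℕ→ℚ m + 1ℚ
  lemma₁ : ∀ n u x v → n * n * (u * u) * x - n ≡ n * (u * (n * u * x + - n * v)) + n * (n * (u * v) - 1ℚ)
  lemma₁ = solve-∀ ℚ-ring
  lemma₂ : ∀ n u a q b e z →
    n * u * (a * q * z) + - n * (a * b * z) ≡ a * b * (n * z * (e - 1ℚ)) + n * a * z * (q * u - b * e)
  lemma₂ = solve-∀ ℚ-ring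
  summand : ∀ j → j ℕ.< suc m →
    n * U m * (U j * q m j * w j) + - n * (U j * U (m ℕ.∸ j) * w j)
    ≡ U j * U (m ℕ.∸ j) * (n * w j * (ε (ℕ→ℚ m + ½) j - 1ℚ))
  summand j (s≤s j≤m) =
    modulo (n * U j * w j) (qU≡Uε j (m ℕ.∸ j) (ℕ.m∸n+n≡m j≤m))
      (lemma₂ n (U m) (U j) (q m j) (U (m ℕ.∸ j)) (ε (ℕ→ℚ m + ½) j) (w j))

-- The denominators of U.

ℕ→ℚ-! : ∀ k → invFact k * ℕ→ℚ (k !) ≡ 1ℚ
ℕ→ℚ-! zero    = refl
ℕ→ℚ-! (suc k) = begin
  invFact k * inv k * ℕ→ℚ (suc k ℕ.* k !)             ≡⟨ cong (invFact k * inv k *_) (ℕ→ℚ-* (suc k) (k !)) ⟩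
  invFact k * inv k * (ℕ→ℚ (suc k) * ℕ→ℚ (k !))       ≡⟨ lemma (invFact k) (inv k) (ℕ→ℚ (suc k)) (ℕ→ℚ (k !)) ⟩
  invFact k * ℕ→ℚ (k !) * (inv k * ℕ→ℚ (suc k))       ≡⟨ cong₂ _*_ (ℕ→ℚ-! k) (inv-suc k) ⟩
  1ℚ                                                  ∎
  where
  lemma : ∀ a b c d → a * b * (c * d) ≡ a * d * (b * c)
  lemma = solve-∀ ℚ-ring

-- 2ᵏ (½)ₖ is the product of the odd numbers below 2k, and 2ᵏ k! that of the even numbers up to 2k.
rising-½ : ∀ k → rising half k * ℕ→ℚ (4 ℕ.^ k) * ℕ→ℚ (k !) ≡ ℕ→ℚ ((k ℕ.+ k) !)
rising-½ zero    = refl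
rising-½ (suc k) = begin
  rising half k * (½ + K) * ℕ→ℚ (4 ℕ.* 4 ℕ.^ k) * ℕ→ℚ (suc k ℕ.* k !)
    ≡⟨ cong₂ (λ x y → rising half k * (½ + K) * x * y) (ℕ→ℚ-* 4 (4 ℕ.^ k)) (trans (ℕ→ℚ-* (suc k) (k !)) (cong (_* ℕ→ℚ (k !)) (ℕ→ℚ-suc k))) ⟩
  rising half k * (½ + K) * (ℕ→ℚ 4 * ℕ→ℚ (4 ℕ.^ k)) * ((K + 1ℚ) * ℕ→ℚ (k !))
    ≡⟨ lemma (rising half k) (ℕ→ℚ (4 ℕ.^ k)) K (ℕ→ℚ (k !)) ⟩
  (K + K + 1ℚ + 1ℚ) * ((K + K + 1ℚ) * (rising half k * ℕ→ℚ (4 ℕ.^ k) * ℕ→ℚ (k !)))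
    ≡⟨ cong₂ (λ x y → (x + 1ℚ) * (x * y)) (sym (ℕ→ℚ-odd k)) (rising-½ k) ⟩
  (ℕ→ℚ (suc (k ℕ.+ k)) + 1ℚ) * (ℕ→ℚ (suc (k ℕ.+ k)) * ℕ→ℚ ((k ℕ.+ k) !))
    ≡⟨ cong₂ _*_ (ℕ→ℚ-suc (suc (k ℕ.+ k))) (ℕ→ℚ-* (suc (k ℕ.+ k)) ((k ℕ.+ k) !)) ⟨
  ℕ→ℚ (suc (suc (k ℕ.+ k))) * ℕ→ℚ (suc (k ℕ.+ k) !)
    ≡⟨ ℕ→ℚ-* (suc (suc (k ℕ.+ k))) (suc (k ℕ.+ k) !) ⟨
  ℕ→ℚ (suc (suc (k ℕ.+ k)) !)
    ≡⟨ cong (λ x → ℕ→ℚ (suc x !)) (ℕ.+-suc k k) ⟨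
  ℕ→ℚ ((suc k ℕ.+ suc k) !) ∎
  where
  K = ℕ→ℚ k
  lemma : ∀ r f K g → r * (½ + K) * (ℕ→ℚ 4 * f) * ((K + 1ℚ) * g) ≡ (K + K + 1ℚ + 1ℚ) * ((K + K + 1ℚ) * (r * f * g))
  lemma = solve-∀ ℚ-ring

-- The integer is the central binomial coefficient of 2k over k. Integrality at p cannot be read off
-- factor by factor: for k ≥ p both (½)ₖ and k! contain p.
U-4^ : ∀ k → ∃[ c ] U k * ℕ→ℚ (4 ℕ.^ k) ≡ ℕ→ℚ c
U-4^ k with subst (λ x → x ! ℕ.* k ! ∣ (k ℕ.+ k) !) (ℕ.m+n∸n≡m k k) ([n∸k]!k!∣n! (ℕ.m≤n+m k k))
... | divides c eq = c , (begin
  R * I * P                      ≡⟨ modulo (- (R * I * P)) (ℕ→ℚ-! k) (lemma₁ R I P F) ⟩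
  I * I * (R * P * F)            ≡⟨ cong (I * I *_) (trans (rising-½ k) (cong ℕ→ℚ eq)) ⟩
  I * I * ℕ→ℚ (c ℕ.* (k ! ℕ.* k !))
    ≡⟨ cong (I * I *_) (trans (ℕ→ℚ-* c (k ! ℕ.* k !)) (cong (ℕ→ℚ c *_) (ℕ→ℚ-* (k !) (k !)))) ⟩
  I * I * (ℕ→ℚ c * (F * F))      ≡⟨ modulo (ℕ→ℚ c * (I * F + 1ℚ)) (ℕ→ℚ-! k) (lemma₂ I F (ℕ→ℚ c)) ⟩
  ℕ→ℚ c                          ∎)
  where
  R = rising half k
  I = invFact k
  P = ℕ→ℚ (4 ℕ.^ k)
  F = ℕ→ℚ (k !)
  lemma₁ : ∀ R I P F → R * I * P ≡ I * I * (R * P * F) + - (R * I * P) * (I * F - 1ℚ)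
  lemma₁ = solve-∀ ℚ-ring
  lemma₂ : ∀ I F c → I * I * (c * (F * F)) ≡ c + c * (I * F + 1ℚ) * (I * F - 1ℚ)
  lemma₂ = solve-∀ ℚ-ring

-- The ideals pᵉ ℤ₍ₚ₎.

module Localization (p : ℕ) (p-prime : Prime p) (p>3 : p ℕ.> 3) where

  p∤product : ∀ {a b} → ¬ p ∣ a → ¬ p ∣ b → ¬ p ∣ a ℕ.* b
  p∤product {a} {b} p∤a p∤b p∣ab with euclidsLemma a b p-prime p∣ab
  ... | inj₁ p∣a = p∤a p∣a
  ... | inj₂ p∣b = p∤b p∣b

  p∤small : ∀ {b} .{{_ : ℕ.NonZero b}} → b ℕ.≤ 3 → ¬ p ∣ b
  p∤small b≤3 = >⇒∤ (ℕ.≤-<-trans b≤3 p>3)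

  p∤4^ : ∀ k → ¬ p ∣ 4 ℕ.^ k
  p∤4^ zero    = p∤small (s≤s z≤n)
  p∤4^ (suc k) = p∤product (p∤product {2} {2} p∤2 p∤2) (p∤4^ k)
    where
    p∤2 : ¬ p ∣ 2
    p∤2 = p∤small (s≤s (s≤s z≤n))

  infix 4 _∈𝔭^_
  -- The condition of `CongMod` on a single rational. As a datatype it is injective in `x` and `e`,
  -- so unification recovers them, whereas `CongMod` unfolds to a difference.
  data _∈𝔭^_ (x : ℚ) (e : ℕ) : Set where
    fraction : ∀ a b → ¬ p ∣ b → x * ℕ→ℚ b ≡ ℕ→ℚ (p ℕ.^ e) * ℤ→ℚ a → x ∈𝔭^ e

  ∈𝔭^⇒CongMod : ∀ A B {e} → A - B ∈𝔭^ e → CongMod A B p e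
  ∈𝔭^⇒CongMod _ _ (fraction a b p∤b eq) = a , b , p∤b , eq

  +-closed : ∀ {e x y} → x ∈𝔭^ e → y ∈𝔭^ e → x + y ∈𝔭^ e
  +-closed {e} {x} {y} (fraction a b p∤b x≡) (fraction a′ b′ p∤b′ y≡) =
    fraction (a ℤ.* ℤ.+ b′ ℤ.+ a′ ℤ.* ℤ.+ b) (b ℕ.* b′) (p∤product p∤b p∤b′) (begin
      (x + y) * ℕ→ℚ (b ℕ.* b′)                  ≡⟨ cong ((x + y) *_) (ℕ→ℚ-* b b′) ⟩
      (x + y) * (ℕ→ℚ b * ℕ→ℚ b′)                ≡⟨ lemma₁ x y (ℕ→ℚ b) (ℕ→ℚ b′) ⟩
      x * ℕ→ℚ b * ℕ→ℚ b′ + y * ℕ→ℚ b′ * ℕ→ℚ b   ≡⟨ cong₂ (λ s t → s * ℕ→ℚ b′ + t * ℕ→ℚ b) x≡ y≡ ⟩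
      P * ℤ→ℚ a * ℕ→ℚ b′ + P * ℤ→ℚ a′ * ℕ→ℚ b   ≡⟨ lemma₂ P (ℤ→ℚ a) (ℕ→ℚ b′) (ℤ→ℚ a′) (ℕ→ℚ b) ⟩
      P * (ℤ→ℚ a * ℕ→ℚ b′ + ℤ→ℚ a′ * ℕ→ℚ b)     ≡⟨ cong₂ (λ s t → P * (s + t)) (ℤ→ℚ-* a (ℤ.+ b′)) (ℤ→ℚ-* a′ (ℤ.+ b)) ⟨
      P * (ℤ→ℚ (a ℤ.* ℤ.+ b′) + ℤ→ℚ (a′ ℤ.* ℤ.+ b))  ≡⟨ cong (P *_) (ℤ→ℚ-+ (a ℤ.* ℤ.+ b′) (a′ ℤ.* ℤ.+ b)) ⟨
      P * ℤ→ℚ (a ℤ.* ℤ.+ b′ ℤ.+ a′ ℤ.* ℤ.+ b)   ∎)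
    where
    P = ℕ→ℚ (p ℕ.^ e)
    lemma₁ : ∀ x y b b′ → (x + y) * (b * b′) ≡ x * b * b′ + y * b′ * b
    lemma₁ = solve-∀ ℚ-ring
    lemma₂ : ∀ P a b a′ b′ → P * a * b + P * a′ * b′ ≡ P * (a * b + a′ * b′)
    lemma₂ = solve-∀ ℚ-ring

  *-graded : ∀ {e f x y} → x ∈𝔭^ e → y ∈𝔭^ f → x * y ∈𝔭^ (e ℕ.+ f)
  *-graded {e} {f} {x} {y} (fraction a b p∤b x≡) (fraction a′ b′ p∤b′ y≡) =
    fraction (a ℤ.* a′) (b ℕ.* b′) (p∤product p∤b p∤b′) (begin
      x * y * ℕ→ℚ (b ℕ.* b′)                    ≡⟨ cong (x * y *_) (ℕ→ℚ-* b b′) ⟩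
      x * y * (ℕ→ℚ b * ℕ→ℚ b′)                  ≡⟨ lemma x y (ℕ→ℚ b) (ℕ→ℚ b′) ⟩
      x * ℕ→ℚ b * (y * ℕ→ℚ b′)                  ≡⟨ cong₂ _*_ x≡ y≡ ⟩
      P * ℤ→ℚ a * (P′ * ℤ→ℚ a′)                 ≡⟨ lemma P P′ (ℤ→ℚ a) (ℤ→ℚ a′) ⟨
      P * P′ * (ℤ→ℚ a * ℤ→ℚ a′)                 ≡⟨ cong₂ _*_ (ℕ→ℚ-* (p ℕ.^ e) (p ℕ.^ f)) (ℤ→ℚ-* a a′) ⟨
      ℕ→ℚ (p ℕ.^ e ℕ.* p ℕ.^ f) * ℤ→ℚ (a ℤ.* a′) ≡⟨ cong (λ t → ℕ→ℚ t * ℤ→ℚ (a ℤ.* a′)) (ℕ.^-distribˡ-+-* p e f) ⟨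
      ℕ→ℚ (p ℕ.^ (e ℕ.+ f)) * ℤ→ℚ (a ℤ.* a′)    ∎)
    where
    P = ℕ→ℚ (p ℕ.^ e)
    P′ = ℕ→ℚ (p ℕ.^ f)
    lemma : ∀ x y b b′ → x * y * (b * b′) ≡ x * b * (y * b′)
    lemma = solve-∀ ℚ-ring

  ℤ-integral : ∀ a → ℤ→ℚ a ∈𝔭^ 0
  ℤ-integral a = fraction a 1 (p∤small (s≤s z≤n)) (*-comm (ℤ→ℚ a) 1ℚ)

  inv-integral : ∀ {k} → ¬ p ∣ suc k → inv k ∈𝔭^ 0
  inv-integral {k} p∤1+k = fraction (ℤ.+ 1) (suc k) p∤1+k (inv-suc k)

  ½-integral : ½ ∈𝔭^ 0
  ½-integral = inv-integral (p∤small (s≤s (s≤s z≤n)))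

  U-integral : ∀ k → U k ∈𝔭^ 0
  U-integral k = fraction (ℤ.+ c) (4 ℕ.^ k) (p∤4^ k) (trans (proj₂ (U-4^ k)) (sym (*-identityˡ (ℕ→ℚ c))))
    where
    c = proj₁ (U-4^ k)

  p^-∈ : ∀ e → ℕ→ℚ (p ℕ.^ e) ∈𝔭^ e
  p^-∈ e = fraction (ℤ.+ 1) 1 (p∤small (s≤s z≤n)) refl

  neg-closed : ∀ {e x} → x ∈𝔭^ e → - x ∈𝔭^ e
  neg-closed {e} {x} x∈ = subst (_∈𝔭^ e) (lemma x) (*-graded (ℤ-integral ℤ.-[1+ 0 ]) x∈)
    where
    lemma : ∀ x → - 1ℚ * x ≡ - x
    lemma = solve-∀ ℚ-ring

  𝔭-decreasing : ∀ {e x} → x ∈𝔭^ suc e → x ∈𝔭^ e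
  𝔭-decreasing {e} {x} (fraction a b p∤b x≡) = fraction (ℤ.+ p ℤ.* a) b p∤b (begin
    x * ℕ→ℚ b                              ≡⟨ x≡ ⟩
    ℕ→ℚ (p ℕ.* p ℕ.^ e) * ℤ→ℚ a            ≡⟨ cong (_* ℤ→ℚ a) (ℕ→ℚ-* p (p ℕ.^ e)) ⟩
    ℕ→ℚ p * ℕ→ℚ (p ℕ.^ e) * ℤ→ℚ a          ≡⟨ lemma (ℕ→ℚ p) (ℕ→ℚ (p ℕ.^ e)) (ℤ→ℚ a) ⟩
    ℕ→ℚ (p ℕ.^ e) * (ℕ→ℚ p * ℤ→ℚ a)        ≡⟨ cong (ℕ→ℚ (p ℕ.^ e) *_) (ℤ→ℚ-* (ℤ.+ p) a) ⟨
    ℕ→ℚ (p ℕ.^ e) * ℤ→ℚ (ℤ.+ p ℤ.* a)      ∎)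
    where
    lemma : ∀ a b c → a * b * c ≡ b * (a * c)
    lemma = solve-∀ ℚ-ring

  0-∈ : ∀ e → 0ℚ ∈𝔭^ e
  0-∈ e = subst (_∈𝔭^ e) (*-zeroˡ (ℕ→ℚ (p ℕ.^ e))) (*-graded (ℤ-integral (ℤ.+ 0)) (p^-∈ e))

  ∑-closed : ∀ {e} n {f : ℕ → ℚ} → (∀ k → k ℕ.< n → f k ∈𝔭^ e) → ∑ n f ∈𝔭^ e
  ∑-closed {e} zero f∈ = 0-∈ e
  ∑-closed (suc n) f∈  = +-closed (∑-closed n (λ k k<n → f∈ k (ℕ.m<n⇒m<1+n k<n))) (f∈ n ℕ.≤-refl)

  -- A positive integer below pʳ is not divisible by pʳ. If p does not divide k+1, a factor p of the
  -- numerator survives; otherwise cancel one p and descend to r - 1.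
  p^/-∈ : ∀ r k → suc k ℕ.< p ℕ.^ r → ℕ→ℚ (p ℕ.^ r) * inv k ∈𝔭^ 1
  p^/-∈ zero    k (s≤s ())
  p^/-∈ (suc r) k 1+k<p^ with p ∣? suc k
  ... | no p∤1+k = *-graded (subst (_∈𝔭^ 1) (sym (ℕ→ℚ-* p (p ℕ.^ r))) p*p^∈) (inv-integral p∤1+k)
    where
    p*p^∈ : ℕ→ℚ p * ℕ→ℚ (p ℕ.^ r) ∈𝔭^ 1
    p*p^∈ = *-graded (subst (λ x → ℕ→ℚ x ∈𝔭^ 1) (ℕ.*-identityʳ p) (p^-∈ 1)) (ℤ-integral (ℤ.+ (p ℕ.^ r)))
  ... | yes (divides (suc l) 1+k≡) = subst (_∈𝔭^ 1) (sym quotient) (p^/-∈ r l 1+l<p^)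
    where
    1+l<p^ : suc l ℕ.< p ℕ.^ r
    1+l<p^ = ℕ.*-cancelˡ-< p (suc l) (p ℕ.^ r) (subst (ℕ._< p ℕ.^ suc r) (trans 1+k≡ (ℕ.*-comm (suc l) p)) 1+k<p^)
    lemma : ∀ a b i j l → a * b * i ≡ b * j + a * b * i * (- 1ℚ) * (j * l - 1ℚ) + b * j * (i * (l * a) - 1ℚ)
    lemma = solve-∀ ℚ-ring
    inv-1+k : inv k * (ℕ→ℚ (suc l) * ℕ→ℚ p) ≡ 1ℚ
    inv-1+k = trans (cong (inv k *_) (trans (sym (ℕ→ℚ-* (suc l) p)) (cong ℕ→ℚ (sym 1+k≡)))) (inv-suc k)
    quotient : ℕ→ℚ (p ℕ.^ suc r) * inv k ≡ ℕ→ℚ (p ℕ.^ r) * inv l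
    quotient = begin
      ℕ→ℚ (p ℕ.* p ℕ.^ r) * inv k        ≡⟨ cong (_* inv k) (ℕ→ℚ-* p (p ℕ.^ r)) ⟩
      ℕ→ℚ p * ℕ→ℚ (p ℕ.^ r) * inv k
        ≡⟨ modulo (ℕ→ℚ p * ℕ→ℚ (p ℕ.^ r) * inv k * (- 1ℚ)) (inv-suc l)
          (modulo (ℕ→ℚ (p ℕ.^ r) * inv l) inv-1+k
          (lemma (ℕ→ℚ p) (ℕ→ℚ (p ℕ.^ r)) (inv k) (inv l) (ℕ→ℚ (suc l)))) ⟩
      ℕ→ℚ (p ℕ.^ r) * inv l              ∎

  -- Estimates for n = pʳ = 2m+1.

  module OddPower (r m : ℕ) (p^r≡1+2m : p ℕ.^ r ≡ suc (m ℕ.+ m)) where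

    n : ℚ
    n = ℕ→ℚ (p ℕ.^ r)

    n≡2m+1 : n ≡ ℕ→ℚ m + ℕ→ℚ m + 1ℚ
    n≡2m+1 = trans (cong ℕ→ℚ p^r≡1+2m) (ℕ→ℚ-odd m)

    n/-∈ : ∀ {k} → k ℕ.< m ℕ.+ m → n * inv k ∈𝔭^ 1
    n/-∈ {k} k<2m = p^/-∈ r k (subst (suc k ℕ.<_) (sym p^r≡1+2m) (s≤s k<2m))

    f : ℕ → ℚ
    f k = n * inv k * (n * inv k)

    -- n/i + n/(n-i) = (n/i)(n/(n-i)) ∈ p²
    f-reflect : ∀ k l → suc (k ℕ.+ l) ≡ m ℕ.+ m → f k - f l ∈𝔭^ 3
    f-reflect k l eq =
      subst (_∈𝔭^ 3) (sym f-f) (*-graded (+-closed n/k (neg-closed n/l)) (*-graded n/k n/l))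
      where
      n/k = n/-∈ (ℕ.≤-trans (s≤s (ℕ.m≤m+n k l)) (ℕ.≤-reflexive eq))
      n/l = n/-∈ (ℕ.≤-trans (s≤s (ℕ.m≤n+m l k)) (ℕ.≤-reflexive eq))
      K = ℕ→ℚ k
      L = ℕ→ℚ l
      n≡ : n ≡ K + 1ℚ + (L + 1ℚ)
      n≡ = begin
        ℕ→ℚ (p ℕ.^ r)                   ≡⟨ cong ℕ→ℚ (trans p^r≡1+2m (cong suc (sym eq))) ⟩
        ℕ→ℚ (suc (suc (k ℕ.+ l)))       ≡⟨ cong ℕ→ℚ (cong suc (ℕ.+-suc k l)) ⟨
        ℕ→ℚ (suc k ℕ.+ suc l)           ≡⟨ ℕ→ℚ-+ (suc k) (suc l) ⟩
        ℕ→ℚ (suc k) + ℕ→ℚ (suc l)       ≡⟨ cong₂ _+_ (ℕ→ℚ-suc k) (ℕ→ℚ-suc l) ⟩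
        K + 1ℚ + (L + 1ℚ)               ∎
      lemma : ∀ n i j K L → n * i * (n * i) - n * j * (n * j) ≡ (n * i + - (n * j)) * (n * i * (n * j))
        + - ((n * i + - (n * j)) * n * i * j) * (n - (K + 1ℚ + (L + 1ℚ)))
        + - ((n * i + - (n * j)) * n * j) * (i * (K + 1ℚ) - 1ℚ)
        + - ((n * i + - (n * j)) * n * i) * (j * (L + 1ℚ) - 1ℚ)
      lemma = solve-∀ ℚ-ring
      f-f : f k - f l ≡ (n * inv k + - (n * inv l)) * (n * inv k * (n * inv l))
      f-f = modulo (- ((n * inv k + - (n * inv l)) * n * inv k * inv l)) n≡
        (modulo (- ((n * inv k + - (n * inv l)) * n * inv l)) (inv-+1 k)
        (modulo (- ((n * inv k + - (n * inv l)) * n * inv k)) (inv-+1 l)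
        (lemma n (inv k) (inv l) K L)))

    -- Since f k is (n/i)² for i = k+1, the index 2k+1 belongs to 2i.
    f-double : ∀ k → f (suc (k ℕ.+ k)) ≡ ½ * ½ * f k
    f-double k = trans (cong (λ x → n * x * (n * x)) inv-double) (lemma n (inv k))
      where
      lemma : ∀ n i → n * (½ * i) * (n * (½ * i)) ≡ ½ * ½ * (n * i * (n * i))
      lemma = solve-∀ ℚ-ring
      i = inv k
      j = inv (suc (k ℕ.+ k))
      K = ℕ→ℚ k
      ring-lemma : ∀ i j K → j ≡ ½ * i + ½ * i * (j * (K + K + 1ℚ + 1ℚ) - 1ℚ) + - j * (i * (K + 1ℚ) - 1ℚ)
      ring-lemma = solve-∀ ℚ-ring
      inv-double : j ≡ ½ * i
      inv-double = modulo (½ * i) (subst (λ x → j * (x + 1ℚ) ≡ 1ℚ) (ℕ→ℚ-odd k) (inv-+1 (suc (k ℕ.+ k))))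
        (modulo (- j) (inv-+1 k) (ring-lemma i j K))

    ∑-difference : ∀ (g h : ℕ → ℚ) → (∀ k → k ℕ.< m → g k - h k ∈𝔭^ 3) → ∑ m g - ∑ m h ∈𝔭^ 3
    ∑-difference g h g-h∈ = subst (_∈𝔭^ 3) (sym eq) (∑-closed m g-h∈)
      where
      lemma : ∀ a b → a - b ≡ a + - 1ℚ * b
      lemma = solve-∀ ℚ-ring
      eq : ∑ m g - ∑ m h ≡ ∑ m (λ k → g k - h k)
      eq = begin
        ∑ m g - ∑ m h                          ≡⟨ lemma (∑ m g) (∑ m h) ⟩
        ∑ m g + - 1ℚ * ∑ m h                   ≡⟨ cong (∑ m g +_) (∑-*ˡ (- 1ℚ) m h) ⟨
        ∑ m g + ∑ m (λ k → - 1ℚ * h k)         ≡⟨ ∑-+ m g (λ k → - 1ℚ * h k) ⟨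
        ∑ m (λ k → g k + - 1ℚ * h k)           ≡⟨ ∑-cong m (λ k _ → lemma (g k) (h k)) ⟨
        ∑ m (λ k → g k - h k)                  ∎

    -- Up to sign and modulo n, both {1,…,m} and its double represent every pair ±i once,
    -- so the sum A satisfies A ≡ A/4.
    ∑f∈𝔭³ : ∑ m f ∈𝔭^ 3
    -- From A + B = C + D, B ≡ A, C ≡ D and D = A/4 follows (3/2) A ≡ 0. The factor ⅔ undoes 3/2,
    -- and `inv 2` = ⅓ is integral because p > 3.
    ∑f∈𝔭³ = subst (_∈𝔭^ 3) (sym solved)
      (*-graded (*-graded (ℤ-integral (ℤ.+ 2)) (inv-integral {2} (p∤small ℕ.≤-refl)))
        (+-closed (neg-closed upper) lower))
      where
      -- In terms of i = k+1, these sum (n/i)² over i ≤ m, over m < i ≤ 2m, and over the odd and the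
      -- even i up to 2m.
      A = ∑ m f
      B = ∑ m (λ k → f (k ℕ.+ m))
      C = ∑ m (λ k → f (k ℕ.+ k))
      D = ∑ m (λ k → f (suc (k ℕ.+ k)))
      upper : B - A ∈𝔭^ 3
      upper = subst (λ x → x - A ∈𝔭^ 3) (sym (∑-reverse m (λ k → f (k ℕ.+ m))))
        (∑-difference (λ k → f (m ℕ.∸ suc k ℕ.+ m)) f (λ k k<m → f-reflect (m ℕ.∸ suc k ℕ.+ m) k (index k k<m)))
        where
        index : ∀ k → k ℕ.< m → suc (m ℕ.∸ suc k ℕ.+ m ℕ.+ k) ≡ m ℕ.+ m
        index k k<m = trans (ℕ-lemma (m ℕ.∸ suc k) m k) (cong (ℕ._+ m) (ℕ.m∸n+n≡m k<m))
          where
          ℕ-lemma : ∀ a b c → suc (a ℕ.+ b ℕ.+ c) ≡ (a ℕ.+ suc c) ℕ.+ b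
          ℕ-lemma = ℕSolver.solve-∀
      lower : C - D ∈𝔭^ 3
      lower = subst (λ x → x - D ∈𝔭^ 3) (sym (∑-reverse m (λ k → f (k ℕ.+ k))))
        (∑-difference (λ k → f (m ℕ.∸ suc k ℕ.+ (m ℕ.∸ suc k))) (λ k → f (suc (k ℕ.+ k)))
          (λ k k<m → f-reflect (m ℕ.∸ suc k ℕ.+ (m ℕ.∸ suc k)) (suc (k ℕ.+ k)) (index k k<m)))
        where
        index : ∀ k → k ℕ.< m → suc (m ℕ.∸ suc k ℕ.+ (m ℕ.∸ suc k) ℕ.+ suc (k ℕ.+ k)) ≡ m ℕ.+ m
        index k k<m = trans (ℕ-lemma (m ℕ.∸ suc k) k) (cong₂ ℕ._+_ (ℕ.m∸n+n≡m k<m) (ℕ.m∸n+n≡m k<m))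
          where
          ℕ-lemma : ∀ a c → suc (a ℕ.+ a ℕ.+ suc (c ℕ.+ c)) ≡ (a ℕ.+ suc c) ℕ.+ (a ℕ.+ suc c)
          ℕ-lemma = ℕSolver.solve-∀
      D≡ : D ≡ ½ * ½ * A
      D≡ = trans (∑-cong m (λ k _ → f-double k)) (∑-*ˡ (½ * ½) m f)
      A+B≡C+D : A + B ≡ C + D
      A+B≡C+D = trans (sym (∑-append m m f)) (∑-pairs m f)
      lemma : ∀ A B C D → A ≡ ℕ→ℚ 2 * inv 2 * (- (B - A) + (C - D))
        + ℕ→ℚ 2 * inv 2 * (A + B - (C + D)) + ℕ→ℚ 2 * inv 2 * ℕ→ℚ 2 * (D - ½ * ½ * A)
      lemma = solve-∀ ℚ-ring
      solved : A ≡ ℕ→ℚ 2 * inv 2 * (- (B - A) + (C - D))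
      solved = modulo (ℕ→ℚ 2 * inv 2) A+B≡C+D (modulo (ℕ→ℚ 2 * inv 2 * ℕ→ℚ 2) D≡ (lemma A B C D))

    h : ℚ
    h = ℕ→ℚ m + ½

    h²≡¼f : ∀ k → h * inv k * (h * inv k) ≡ ½ * ½ * f k
    h²≡¼f k = sym (trans (cong (λ x → ½ * ½ * (x * inv k * (x * inv k))) n≡2m+1) (lemma (ℕ→ℚ m) (inv k)))
      where
      lemma : ∀ M i → ½ * ½ * ((M + M + 1ℚ) * i * ((M + M + 1ℚ) * i)) ≡ (M + ½) * i * ((M + ½) * i)
      lemma = solve-∀ ℚ-ring

    h²∈𝔭² : ∀ {k} → k ℕ.< m → h * inv k * (h * inv k) ∈𝔭^ 2
    h²∈𝔭² {k} k<m = subst (_∈𝔭^ 2) (sym (h²≡¼f k))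
      (*-graded (*-graded ½-integral ½-integral) (*-graded n/k n/k))
      where
      n/k : n * inv k ∈𝔭^ 1
      n/k = n/-∈ (ℕ.<-≤-trans k<m (ℕ.m≤m+n m m))

    ε-1∈𝔭² : ∀ {j} → j ℕ.≤ m → ε h j - 1ℚ ∈𝔭^ 2
    ε-1∈𝔭² {zero}  _   = 0-∈ 2
    ε-1∈𝔭² {suc j} j<m = subst (_∈𝔭^ 2) (sym (lemma (ε h j) (h * inv j * (h * inv j))))
      (+-closed (ε-1∈𝔭² (ℕ.<⇒≤ j<m))
        (neg-closed (+-closed (h²∈𝔭² j<m) (𝔭-decreasing (𝔭-decreasing (*-graded (ε-1∈𝔭² (ℕ.<⇒≤ j<m)) (h²∈𝔭² j<m)))))))
      where
      lemma : ∀ e x → e * (1ℚ - x) - 1ℚ ≡ e - 1ℚ + - (x + (e - 1ℚ) * x)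
      lemma = solve-∀ ℚ-ring

    -- First-order expansion of the product: each neglected term (εⱼ - 1)(h/i)² even lies in 𝔭⁴.
    ε-linear : ∀ {j} → j ℕ.≤ m → ε h j - 1ℚ + ½ * ½ * ∑ j f ∈𝔭^ 3
    ε-linear {zero}  _   = 0-∈ 3
    ε-linear {suc j} j<m = subst (_∈𝔭^ 3) (sym eq)
      (+-closed (ε-linear (ℕ.<⇒≤ j<m)) (neg-closed (𝔭-decreasing (*-graded (ε-1∈𝔭² (ℕ.<⇒≤ j<m)) (h²∈𝔭² j<m)))))
      where
      lemma : ∀ e x s y → e * (1ℚ - x) - 1ℚ + ½ * ½ * (s + y)
        ≡ e - 1ℚ + ½ * ½ * s + - ((e - 1ℚ) * x) + - 1ℚ * (x - ½ * ½ * y)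
      lemma = solve-∀ ℚ-ring
      eq = modulo (- 1ℚ) (h²≡¼f j) (lemma (ε h j) (h * inv j * (h * inv j)) (∑ j f) (f j))

    εₘ-1∈𝔭³ : ε h m - 1ℚ ∈𝔭^ 3
    εₘ-1∈𝔭³ = subst (_∈𝔭^ 3) (sym (lemma (ε h m) (∑ m f)))
      (+-closed (ε-linear ℕ.≤-refl) (neg-closed (*-graded (*-graded ½-integral ½-integral) ∑f∈𝔭³)))
      where
      lemma : ∀ e s → e - 1ℚ ≡ e - 1ℚ + ½ * ½ * s + - (½ * ½ * s)
      lemma = solve-∀ ℚ-ring

    weighted-ε∈𝔭³ : ∀ {j} → j ℕ.≤ m → n * w j * (ε h j - 1ℚ) ∈𝔭^ 3
    weighted-ε∈𝔭³ {j} j≤m with ℕ.m≤n⇒m<n∨m≡n j≤m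
    ... | inj₁ j<m  = *-graded (n/-∈ (ℕ.+-mono-< j<m j<m)) (ε-1∈𝔭² j≤m)
    ... | inj₂ refl = subst (_∈𝔭^ 3) (sym unit) εₘ-1∈𝔭³
      where
      unit : n * w m * (ε h m - 1ℚ) ≡ ε h m - 1ℚ
      unit = begin
        n * w m * (ε h m - 1ℚ)                        ≡⟨ cong (_* (ε h m - 1ℚ)) (trans (*-comm n (w m)) (cong (w m *_) n≡2m+1)) ⟩
        w m * (ℕ→ℚ m + ℕ→ℚ m + 1ℚ) * (ε h m - 1ℚ)     ≡⟨ cong (_* (ε h m - 1ℚ)) (w-odd m) ⟩
        1ℚ * (ε h m - 1ℚ)                             ≡⟨ *-identityˡ (ε h m - 1ℚ) ⟩
        ε h m - 1ℚ                                    ∎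

    supercongruence : sumTo m term - n ∈𝔭^ (3 ℕ.+ r)
    supercongruence = subst (λ e → sumTo m term - n ∈𝔭^ e) (ℕ.+-comm r 3)
      (subst (_∈𝔭^ (r ℕ.+ 3)) (sym eq)
        (*-graded (p^-∈ r) (*-graded (U-integral m) (∑-closed (suc m) (λ { j (s≤s j≤m) →
          *-graded (*-graded (U-integral j) (U-integral (m ℕ.∸ j))) (weighted-ε∈𝔭³ j≤m) })))))
      where
      summands : ℚ → ℕ → ℚ
      summands n j = U j * U (m ℕ.∸ j) * (n * w j * (ε h j - 1ℚ))
      eq : sumTo m term - n ≡ n * (U m * ∑ (suc m) (summands n))
      eq = begin
        sumTo m term - n                 ≡⟨ cong (_- n) (sumTo≡∑ m term) ⟩
        ∑ (suc m) term - n               ≡⟨ subst (λ x → ∑ (suc m) term - x ≡ x * (U m * ∑ (suc m) (summands x))) (sym n≡2m+1) (∑term-n m) ⟩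
        n * (U m * ∑ (suc m) (summands n)) ∎

-- Parity of pʳ and the conclusion.

odd-prime-power : ∀ {p} r → Prime p → p ℕ.> 3 → p ℕ.^ r ≡ suc ((p ℕ.^ r ℕ.∸ 1) / 2 ℕ.+ (p ℕ.^ r ℕ.∸ 1) / 2)
odd-prime-power {p} r p-prime p>3 with p ℕ.^ r % 2 in n%2 | m%n<n (p ℕ.^ r) 2 | m≡m%n+[m/n]*n (p ℕ.^ r) 2
... | 0 | _ | _  = ⊥-elim (2∤p^ r (m%n≡0⇒n∣m (p ℕ.^ r) 2 n%2))
  where
  2∤p : ¬ 2 ∣ p
  2∤p 2∣p = Prime.notComposite p-prime (hasNonTrivialDivisor (ℕ.<-trans ℕ.≤-refl p>3) 2∣p)
  2∤p^ : ∀ r → ¬ 2 ∣ p ℕ.^ r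
  2∤p^ zero    2∣1  = >⇒∤ ℕ.≤-refl 2∣1
  2∤p^ (suc r) 2∣p^ with euclidsLemma p (p ℕ.^ r) prime[2] 2∣p^
  ... | inj₁ 2∣p = 2∤p 2∣p
  ... | inj₂ 2∣p^r = 2∤p^ r 2∣p^r
... | 1 | _ | eq = begin
  p ℕ.^ r                  ≡⟨ eq ⟩
  suc (k ℕ.* 2)            ≡⟨ cong suc (trans (ℕ.*-comm k 2) (cong (k ℕ.+_) (ℕ.+-identityʳ k))) ⟩
  suc (k ℕ.+ k)            ≡⟨ cong (λ x → suc (x ℕ.+ x)) half≡ ⟨
  suc ((p ℕ.^ r ℕ.∸ 1) / 2 ℕ.+ (p ℕ.^ r ℕ.∸ 1) / 2) ∎
  where
  k = p ℕ.^ r / 2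
  half≡ : (p ℕ.^ r ℕ.∸ 1) / 2 ≡ k
  half≡ = trans (cong (λ x → (x ℕ.∸ 1) / 2) eq) (m*n/n≡m k 2)
... | suc (suc _) | s≤s (s≤s ()) | _

theorem1 : (p r : ℕ) → Prime p → p > 3 → r > 0 →
    CongMod (sumTo ((p ^ r ∸ 1) / 2) term) (ℕ→ℚ (p ^ r)) p (3 ℕ.+ r)
theorem1 p r p-prime p>3 r>0 =
  ∈𝔭^⇒CongMod (sumTo ((p ^ r ∸ 1) / 2) term) (ℕ→ℚ (p ^ r))
    (supercongruence r ((p ^ r ∸ 1) / 2) (odd-prime-power r p-prime p>3))
  where
  open Localization p p-prime p>3
  open OddPower
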